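{- For all sufficiently large $n$, the set of $G\in F(n,4,15)$ maximizing $P(G)$ over $F(n,4,15)$ equals the set of $G\in D(n)$ maximizing $P(G)$ over $D(n)$.
   Context: A multigraph is $(V,w)$ with $w:\binom V2\to\mathbb{N}$; $\mu(G)=\max w$, $P(G)=\prod_{xy}w(xy)$. An $(s,q)$-graph is a multigraph in which every $s$ vertices span total multiplicity at most $q$; $F(n,s,q)$ is the set of $(s,q)$-graphs on vertex set $[n]$. $D(n)=\{G\in F(n,4,15):\mu(G)\le 3\}\cap F(n,3,8)$. -}

module Defs where

open import Data.Nat using (ℕ; _+_; _*_; _≤_; _⊔_)
open import Data.Fin using (Fin; _<?_)
open import Data.Fin.Subset using (Subset; ∣_∣)
open import Data.Fin.Subset.Properties using (_∈?_)
open import Data.List using (List; map; filter; concatMap; foldr)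
open import Data.Nat.ListAction using (sum; product)
open import Data.List.Base using (allFin)
open import Data.Product using (_×_; _,_; proj₁; proj₂)
open import Relation.Binary.PropositionalEquality using (_≡_)
open import Relation.Nullary.Decidable using (_×-dec_)

-- A multigraph on vertex set [n] = Fin n: the multiplicity of the
-- unordered pair {i,j} (i ≠ j) is  w i j  for i < j.
-- Only the values w i j with i < j are ever used.
Multigraph : ℕ → Set
Multigraph n = Fin n → Fin n → ℕ

pairs : (n : ℕ) → List (Fin n × Fin n)
pairs n = filter (λ p → proj₁ p <? proj₂ p)
            (concatMap (λ i → map (λ j → (i , j)) (allFin n)) (allFin n))

weights : {n : ℕ} → Multigraph n → List ℕ
weights {n} w = map (λ p → w (proj₁ p) (proj₂ p)) (pairs n)

-- μ(G) = max multiplicity (0 for n < 2)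
μ : {n : ℕ} → Multigraph n → ℕ
μ w = foldr _⊔_ 0 (weights w)

P : {n : ℕ} → Multigraph n → ℕ
P w = product (weights w)

spanned : {n : ℕ} → Multigraph n → Subset n → ℕ
spanned {n} w S =
  sum (map (λ p → w (proj₁ p) (proj₂ p))
           (filter (λ p → (proj₁ p ∈? S) ×-dec (proj₂ p ∈? S)) (pairs n)))

IsSQ : {n : ℕ} → ℕ → ℕ → Multigraph n → Set
IsSQ {n} s q w = (S : Subset n) → ∣ S ∣ ≡ s → spanned w S ≤ q

F : (n s q : ℕ) → Multigraph n → Set
F n s q w = IsSQ {n} s q w

D : (n : ℕ) → Multigraph n → Set
D n w = (F n 4 15 w × μ w ≤ 3) × F n 3 8 w

IsPMax : {n : ℕ} → (Multigraph n → Set) → Multigraph n → Set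
IsPMax Φ w = Φ w × ((H : _) → Φ H → P H ≤ P w)

{-# OPTIONS --safe #-}
module Submission where

open import Defs
open import Data.Bool using (Bool; true; false)
open import Data.Fin using (Fin; zero; suc; toℕ)
import Data.Fin as Fin
import Data.Fin.Properties as Fin
open import Data.Fin.Subset using (Subset; ∣_∣; ⁅_⁆; _∪_)
import Data.Fin.Subset as Subset
open import Data.Fin.Subset.Properties using (_∈?_)
import Data.Fin.Subset.Properties as Subset
open import Data.List hiding ([_]; head; tail; find; sum; product; or; and; any; all)
open import Data.List.Membership.Propositional using (_∈_; find; lose)
open import Data.List.Membership.Propositional.Properties
  using (∈-filter⁺; ∈-filter⁻; ∈-allFin; ∈-lookup; ∈-∃++; ∈-++⁺ˡ)
open import Data.List.Membership.Propositional.Properties.WithK using (unique∧set⇒bag)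
open import Data.List.Properties
open import Data.List.Relation.Binary.BagAndSetEquality using (∼bag⇒↭)
open import Data.List.Relation.Binary.Permutation.Propositional
  using (_↭_; prep; swap; ↭-refl; ↭-sym; ↭-trans; ↭-reflexive; ↭⇒↭ₛ)
import Data.List.Relation.Binary.Permutation.Propositional as ↭
open import Data.List.Relation.Binary.Permutation.Propositional.Properties
  using (++⁺; shift; shifts; ↭-length; ∈-resp-↭; All-resp-↭)
  renaming (map⁺ to ↭-map⁺)
import Data.List.Relation.Binary.Permutation.Setoid.Properties as ↭ₛ
open import Data.List.Relation.Unary.All using (All; []; _∷_)
import Data.List.Relation.Unary.All as All
import Data.List.Relation.Unary.All.Properties as All
open import Data.List.Relation.Unary.AllPairs using (AllPairs; []; _∷_)
import Data.List.Relation.Unary.AllPairs as AllPairs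
import Data.List.Relation.Unary.AllPairs.Properties as AllPairs
open import Data.List.Relation.Unary.Any using (Any; here; there; any?)
open import Data.List.Relation.Unary.Unique.Propositional using (Unique)
import Data.List.Relation.Unary.Unique.Propositional.Properties as Unique
open import Data.Nat hiding (_≟_; _<?_)
open import Data.Nat.ListAction using (sum; product)
open import Data.Nat.ListAction.Properties using (sum-↭; product-↭; product-++)
open import Data.Nat.Properties hiding (_≟_)
open import Data.Nat.Tactic.RingSolver using (solve-∀)
open import Data.Product using (∃; _×_; _,_; proj₁; proj₂; uncurry)
open import Data.Sum using (_⊎_; inj₁; inj₂)
import Data.Vec as Vec
open import Function using (_∘_; id)
open import Function.Bundles using (_⇔_; mk⇔)
open import Relation.Binary.Definitions using (DecidableEquality; tri<; tri≈; tri>)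
open import Relation.Binary.PropositionalEquality
open import Relation.Nullary
open import Relation.Nullary.Decidable using (True; toWitness; from-no; map′; _×-dec_; _→-dec_)
open import Relation.Unary using (Decidable)

-- Multiplicity 1 between a vertex and its clone keeps a member of D(n) in D(n + 1). Cloning the
-- vertex of largest degree product, in a graph at least as good as the explicit construction with a
-- quarter of the vertices joined to the rest by 3, multiplies P³ by at least 10ⁿ / 16.
--
-- Let G be in F(n,4,15) but not in D(n), with all multiplicities positive. If a triangle xyz spans
-- at least 9, every other vertex sends at most 6 to it, so deleting x, y, z divides P by at most
-- C·8ⁿ, while three clones multiply it by about 10ⁿ. If w(xy) ≥ 4, let A be the vertices sending at
-- least 5 to {x,y}; multiplicities inside A are at most 1 and, with one exception, the product of
-- the two multiplicities is at most 6 on A and at most 4 elsewhere. If |A| ≤ n/3, deleting x, y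
-- divides P³ by at most C·96ⁿ. Otherwise delete two vertices of A: they are joined to A by 1, and
-- the product of their multiplicities to an outer vertex is at most 9 with one exception, which is
-- again at most C·96ⁿ in P³. Two clones gain about 100ⁿ > 96ⁿ in P³. So deleting and then cloning
-- improves P by an arbitrary constant factor once n is large, and an induction on n shows that the
-- graphs of D(n) eventually win.

-- Sums over subsets of `Fin n` as sums over duplicate-free lists.

edgeWeights : {A B : Set} → (A → A → B) → List A → List B
edgeWeights s []       = []
edgeWeights s (x ∷ xs) = map (s x) xs ++ edgeWeights s xs

-- Symmetry enters only where two adjacent entries are swapped. This lets chosen vertices be moved
-- to the front of the list before they are deleted.
edgeWeights-↭ : {A B : Set} {s : A → A → B} → (∀ x y → s x y ≡ s y x) → {xs ys : List A} →
  xs ↭ ys → edgeWeights s xs ↭ edgeWeights s ys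
edgeWeights-↭ sym-s ↭.refl = ↭.refl
edgeWeights-↭ {s = s} sym-s (prep x p) = ++⁺ (↭-map⁺ (s x) p) (edgeWeights-↭ sym-s p)
edgeWeights-↭ {s = s} sym-s (swap {xs} {ys} x y p) rewrite sym-s x y =
  prep (s y x) (↭-trans (shifts (map (s x) xs) (map (s y) xs))
    (++⁺ (↭-map⁺ (s y) p) (++⁺ (↭-map⁺ (s x) p) (edgeWeights-↭ sym-s p))))
edgeWeights-↭ sym-s (↭.trans p q) = ↭-trans (edgeWeights-↭ sym-s p) (edgeWeights-↭ sym-s q)

edgeWeights-map : {A B C : Set} (s : B → B → C) (f : A → B) (xs : List A) →
  edgeWeights s (map f xs) ≡ edgeWeights (λ x y → s (f x) (f y)) xs
edgeWeights-map s f [] = refl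
edgeWeights-map s f (x ∷ xs) = cong₂ _++_ (sym (map-∘ xs)) (edgeWeights-map s f xs)

map-edgeWeights : {A B C : Set} (g : B → C) (s : A → A → B) (xs : List A) →
  map g (edgeWeights s xs) ≡ edgeWeights (λ x y → g (s x y)) xs
map-edgeWeights g s [] = refl
map-edgeWeights g s (x ∷ xs) =
  trans (map-++ g (map (s x) xs) _) (cong₂ _++_ (sym (map-∘ xs)) (map-edgeWeights g s xs))

edgeWeights-cong : {A B : Set} {s t : A → A → B} {xs : List A} →
  AllPairs (λ x y → s x y ≡ t x y) xs → edgeWeights s xs ≡ edgeWeights t xs
edgeWeights-cong [] = refl
edgeWeights-cong (x≈xs ∷ xs≈) = cong₂ _++_ (map-cong-local x≈xs) (edgeWeights-cong xs≈)

filter-map : {A B : Set} {Q : B → Set} (Q? : Decidable Q) (f : A → B) (xs : List A) →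
  filter Q? (map f xs) ≡ map f (filter (λ x → Q? (f x)) xs)
filter-map Q? f [] = refl
filter-map Q? f (x ∷ xs) with does (Q? (f x))
... | true  = cong (f x ∷_) (filter-map Q? f xs)
... | false = filter-map Q? f xs

filter-does : {A : Set} {P Q : A → Set} (P? : Decidable P) (Q? : Decidable Q) →
  (∀ x → does (P? x) ≡ does (Q? x)) → (xs : List A) → filter P? xs ≡ filter Q? xs
filter-does P? Q? eq [] = refl
filter-does P? Q? eq (x ∷ xs) rewrite eq x with does (Q? x)
... | true  = cong (x ∷_) (filter-does P? Q? eq xs)
... | false = filter-does P? Q? eq xs

filter-concatMap : {A B : Set} {Q : B → Set} (Q? : Decidable Q) (f : A → List B) (xs : List A) →
  filter Q? (concatMap f xs) ≡ concatMap (λ x → filter Q? (f x)) xs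
filter-concatMap Q? f [] = refl
filter-concatMap Q? f (x ∷ xs) =
  trans (filter-++ Q? (f x) _) (cong (filter Q? (f x) ++_) (filter-concatMap Q? f xs))

allFin-suc : ∀ n → allFin (suc n) ≡ zero ∷ map suc (allFin n)
allFin-suc n = cong (zero ∷_) (sym (map-tabulate id suc))

row : {n : ℕ} → Fin n → List (Fin n × Fin n)
row {n} i = map (i ,_) (filter (i Fin.<?_) (allFin n))

pairs-rows : ∀ n → pairs n ≡ concatMap row (allFin n)
pairs-rows n = trans (filter-concatMap _ (λ i → map (i ,_) (allFin n)) (allFin n))
  (concatMap-cong (λ i → filter-map (λ p → proj₁ p Fin.<? proj₂ p) (i ,_) (allFin n)) (allFin n))

row-zero : ∀ n → row {suc n} zero ≡ map (zero ,_) (map suc (allFin n))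
row-zero n = cong (map (zero ,_)) (trans (cong (filter (first Fin.<?_)) (allFin-suc n))
  (trans (filter-map (first Fin.<?_) suc (allFin n))
    (cong (map suc) (filter-all (λ j → first Fin.<? suc j) (All.universal (λ j → s≤s (z≤n {toℕ j})) (allFin n))))))
  where
  first : Fin (suc n)
  first = zero

row-suc : ∀ {n} (i : Fin n) → row (suc i) ≡ map (λ p → suc (proj₁ p) , suc (proj₂ p)) (row i)
row-suc {n} i = begin
  map (suc i ,_) (filter (suc i Fin.<?_) (allFin (suc n)))
    ≡⟨ cong (map (suc i ,_) ∘ filter (suc i Fin.<?_)) (allFin-suc n) ⟩
  map (suc i ,_) (filter (suc i Fin.<?_) (map suc (allFin n)))
    ≡⟨ cong (map (suc i ,_)) (filter-map (suc i Fin.<?_) suc (allFin n)) ⟩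
  map (suc i ,_) (map suc (filter (λ j → suc i Fin.<? suc j) (allFin n)))
    ≡⟨ cong (map (suc i ,_) ∘ map suc) (filter-does (λ j → suc i Fin.<? suc j) (i Fin.<?_) (λ _ → refl) (allFin n)) ⟩
  map (suc i ,_) (map suc (filter (i Fin.<?_) (allFin n)))
    ≡⟨ map-∘ (filter (i Fin.<?_) (allFin n)) ⟨
  map (λ j → suc i , suc j) (filter (i Fin.<?_) (allFin n))
    ≡⟨ map-∘ (filter (i Fin.<?_) (allFin n)) ⟩
  map (λ p → suc (proj₁ p) , suc (proj₂ p)) (row i) ∎
  where open ≡-Reasoning

-- Induction on `n`: the row of `zero` comes first, and the other rows are those of `n` with both
-- entries shifted by `suc`. The filtered enumeration thus becomes a recursion on the vertex list.
pairs-edges : ∀ n → pairs n ≡ edgeWeights _,_ (allFin n)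
pairs-edges zero = refl
pairs-edges (suc n) = begin
  pairs (suc n) ≡⟨ pairs-rows (suc n) ⟩
  concatMap row (allFin (suc n)) ≡⟨ cong (concatMap row) (allFin-suc n) ⟩
  row zero ++ concatMap row (map suc (allFin n))
    ≡⟨ cong₂ _++_ (row-zero n) (concatMap-map row suc (allFin n)) ⟩
  map (zero ,_) (map suc (allFin n)) ++ concatMap (row ∘ suc) (allFin n)
    ≡⟨ cong (map (zero ,_) (map suc (allFin n)) ++_) (trans (concatMap-cong row-suc (allFin n))
         (sym (map-concatMap shift² row (allFin n)))) ⟩
  map (zero ,_) (map suc (allFin n)) ++ map shift² (concatMap row (allFin n))
    ≡⟨ cong (λ ps → map (zero ,_) (map suc (allFin n)) ++ map shift² ps)
         (trans (sym (pairs-rows n)) (pairs-edges n)) ⟩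
  map (zero ,_) (map suc (allFin n)) ++ map shift² (edgeWeights _,_ (allFin n))
    ≡⟨ cong (map (zero ,_) (map suc (allFin n)) ++_)
         (trans (map-edgeWeights shift² _,_ (allFin n)) (sym (edgeWeights-map _,_ suc (allFin n)))) ⟩
  edgeWeights _,_ (zero ∷ map suc (allFin n)) ≡⟨ cong (edgeWeights _,_) (allFin-suc n) ⟨
  edgeWeights _,_ (allFin (suc n)) ∎
  where
  open ≡-Reasoning
  shift² : ∀ {n} → Fin n × Fin n → Fin (suc n) × Fin (suc n)
  shift² p = suc (proj₁ p) , suc (proj₂ p)

filter-edges : {A : Set} {Q : A → Set} (Q? : Decidable Q) (xs : List A) →
  filter (λ p → Q? (proj₁ p) ×-dec Q? (proj₂ p)) (edgeWeights _,_ xs) ≡ edgeWeights _,_ (filter Q? xs)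
filter-edges Q? [] = refl
filter-edges {A} {Q} Q? (x ∷ xs) = begin
  filter Q²? (map (x ,_) xs ++ edgeWeights _,_ xs)
    ≡⟨ filter-++ Q²? (map (x ,_) xs) _ ⟩
  filter Q²? (map (x ,_) xs) ++ filter Q²? (edgeWeights _,_ xs)
    ≡⟨ cong₂ _++_ (filter-map Q²? (x ,_) xs) (filter-edges Q? xs) ⟩
  map (x ,_) (filter (λ y → Q²? (x , y)) xs) ++ edgeWeights _,_ (filter Q? xs)
    ≡⟨ head ⟩
  edgeWeights _,_ (filter Q? (x ∷ xs)) ∎
  where
  open ≡-Reasoning
  Q²? = λ (p : A × A) → Q? (proj₁ p) ×-dec Q? (proj₂ p)
  head : map (x ,_) (filter (λ y → Q²? (x , y)) xs) ++ edgeWeights _,_ (filter Q? xs) ≡ edgeWeights _,_ (filter Q? (x ∷ xs))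
  head with Q? x in eq
  ... | yes q = cong (λ ys → map (x ,_) ys ++ edgeWeights _,_ (filter Q? xs))
                 (filter-does (λ y → yes q ×-dec Q? y) Q? (λ _ → refl) xs)
  ... | no ¬q = cong (λ ys → map (x ,_) ys ++ edgeWeights _,_ (filter Q? xs))
                 (filter-none (λ y → no ¬q ×-dec Q? y) (All.universal (λ _ → ¬q ∘ proj₁) xs))

elements : {n : ℕ} → Subset n → List (Fin n)
elements {n} S = filter (_∈? S) (allFin n)

weights-edges : ∀ {n} (w : Multigraph n) → weights w ≡ edgeWeights w (allFin n)
weights-edges {n} w = trans (cong (map (uncurry w)) (pairs-edges n)) (map-edgeWeights (uncurry w) _,_ (allFin n))

spanned-edges : ∀ {n} (w : Multigraph n) S → spanned w S ≡ sum (edgeWeights w (elements S))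
spanned-edges {n} w S = cong sum (begin
  map (uncurry w) (filter _ (pairs n)) ≡⟨ cong (map (uncurry w) ∘ filter _) (pairs-edges n) ⟩
  map (uncurry w) (filter _ (edgeWeights _,_ (allFin n))) ≡⟨ cong (map (uncurry w)) (filter-edges (_∈? S) (allFin n)) ⟩
  map (uncurry w) (edgeWeights _,_ (elements S)) ≡⟨ map-edgeWeights (uncurry w) _,_ (elements S) ⟩
  edgeWeights w (elements S) ∎)
  where open ≡-Reasoning

length-elements : ∀ {n} (S : Subset n) → length (elements S) ≡ ∣ S ∣
length-elements Vec.[] = refl
length-elements {suc n} (b Vec.∷ S) = begin
  length (filter (_∈? (b Vec.∷ S)) (allFin (suc n)))
    ≡⟨ cong (length ∘ filter (_∈? (b Vec.∷ S))) (allFin-suc n) ⟩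
  length (filter (_∈? (b Vec.∷ S)) (zero ∷ map suc (allFin n)))
    ≡⟨ head b ⟩
  ∣ b Vec.∷ S ∣ ∎
  where
  open ≡-Reasoning
  tail : ∀ b → length (filter (_∈? (b Vec.∷ S)) (map suc (allFin n))) ≡ ∣ S ∣
  tail b = trans (cong length (filter-map (_∈? (b Vec.∷ S)) suc (allFin n)))
    (trans (length-map suc (filter (λ i → suc i ∈? (b Vec.∷ S)) (allFin n)))
    (trans (cong length (filter-does (λ i → suc i ∈? (b Vec.∷ S)) (_∈? S) (λ _ → refl) (allFin n)))
      (length-elements S)))
  head : ∀ b → length (filter (_∈? (b Vec.∷ S)) (zero ∷ map suc (allFin n))) ≡ ∣ b Vec.∷ S ∣
  head true  = cong suc (tail true)
  head false = tail false

elements-unique : ∀ {n} (S : Subset n) → Unique (elements S)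
elements-unique {n} S = Unique.filter⁺ (_∈? S) (Unique.allFin⁺ n)

fromList : ∀ {n} → List (Fin n) → Subset n
fromList = foldr (λ x S → ⁅ x ⁆ ∪ S) Subset.⊥

∈-fromList⁺ : ∀ {n} {x : Fin n} {xs} → x ∈ xs → x Subset.∈ fromList xs
∈-fromList⁺ {x = x} (here refl) = Subset.x∈p∪q⁺ (inj₁ (Subset.x∈⁅x⁆ x))
∈-fromList⁺ (there x∈xs) = Subset.x∈p∪q⁺ (inj₂ (∈-fromList⁺ x∈xs))

∈-fromList⁻ : ∀ {n} {x : Fin n} xs → x Subset.∈ fromList xs → x ∈ xs
∈-fromList⁻ [] x∈ = contradiction x∈ Subset.∉⊥
∈-fromList⁻ (y ∷ xs) x∈ with Subset.x∈p∪q⁻ ⁅ y ⁆ (fromList xs) x∈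
... | inj₁ x∈y = here (Subset.x∈⁅y⁆⇒x≡y y x∈y)
... | inj₂ x∈xs = there (∈-fromList⁻ xs x∈xs)

-- Two duplicate-free lists with the same members agree as bags, hence are permutations of each
-- other.
elements-fromList : ∀ {n} {xs : List (Fin n)} → Unique xs → elements (fromList xs) ↭ xs
elements-fromList {xs = xs} u = ∼bag⇒↭ (unique∧set⇒bag (elements-unique (fromList xs)) u
  (mk⇔ (λ x∈ → ∈-fromList⁻ xs (proj₂ (∈-filter⁻ (_∈? fromList xs) {xs = allFin _} x∈)))
       (λ x∈ → ∈-filter⁺ (_∈? fromList xs) (∈-allFin _) (∈-fromList⁺ x∈))))

module _ {n : ℕ} (w s : Multigraph n) (s-sym : ∀ x y → s x y ≡ s y x)
         (w≡s : ∀ {x y} → x Fin.< y → w x y ≡ s x y) where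

  private
    ascending : AllPairs Fin._<_ (allFin n)
    ascending = AllPairs.tabulate⁺-< id

  weights-sym : weights w ≡ edgeWeights s (allFin n)
  weights-sym = trans (weights-edges w) (edgeWeights-cong (AllPairs.map w≡s ascending))

  spanned-sym : ∀ S → spanned w S ≡ sum (edgeWeights s (elements S))
  spanned-sym S = trans (spanned-edges w S)
    (cong sum (edgeWeights-cong (AllPairs.map w≡s (AllPairs.filter⁺ (_∈? S) ascending))))

  -- The list need not be ascending, while `w` is meaningful only on ascending pairs. The symmetric
  -- `s` agrees with `w` there and makes the sum independent of the order.
  F⇒sum≤ : ∀ {k q} → F n k q w → (xs : List (Fin n)) → Unique xs → length xs ≡ k → sum (edgeWeights s xs) ≤ q
  F⇒sum≤ {k} {q} Fw xs u len = subst (_≤ q)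
    (trans (spanned-sym (fromList xs)) (sum-↭ (edgeWeights-↭ s-sym (elements-fromList u))))
    (Fw (fromList xs) (trans (sym (length-elements (fromList xs))) (trans (↭-length (elements-fromList u)) len)))

  sum≤⇒F : ∀ {k q} → (∀ xs → Unique xs → length xs ≡ k → sum (edgeWeights s xs) ≤ q) → F n k q w
  sum≤⇒F {k} {q} h S ∣S∣ = subst (_≤ q) (sym (spanned-sym S))
    (h (elements S) (elements-unique S) (trans (length-elements S) ∣S∣))

-- Powers, products over lists, and the product of all multiplicities.

^-distribʳ-* : ∀ k a b → (a * b) ^ k ≡ a ^ k * b ^ k
^-distribʳ-* zero a b = refl
^-distribʳ-* (suc k) a b = trans (cong (a * b *_) (^-distribʳ-* k a b)) (interchange a b (a ^ k) (b ^ k))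
  where
  interchange : ∀ a b c d → a * b * (c * d) ≡ a * c * (b * d)
  interchange = solve-∀

^-cancelˡ-≤ : ∀ k .{{_ : NonZero k}} {a b} → a ^ k ≤ b ^ k → a ≤ b
^-cancelˡ-≤ k {a} {b} a^k≤b^k with a ≤? b
... | yes a≤b = a≤b
... | no a≰b = contradiction a^k≤b^k (<⇒≱ (^-monoˡ-< k (≰⇒> a≰b)))

∏ : {A : Set} → (A → ℕ) → List A → ℕ
∏ f xs = product (map f xs)

∏-* : {A : Set} (f g : A → ℕ) (xs : List A) → ∏ (λ x → f x * g x) xs ≡ ∏ f xs * ∏ g xs
∏-* f g [] = refl
∏-* f g (x ∷ xs) = trans (cong (f x * g x *_) (∏-* f g xs)) (interchange (f x) (g x) (∏ f xs) (∏ g xs))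
  where
  interchange : ∀ a b c d → a * b * (c * d) ≡ a * c * (b * d)
  interchange = solve-∀

∏-^ : {A : Set} (k : ℕ) (f : A → ℕ) (xs : List A) → ∏ (λ x → f x ^ k) xs ≡ ∏ f xs ^ k
∏-^ k f [] = sym (^-zeroˡ k)
∏-^ k f (x ∷ xs) = trans (cong (f x ^ k *_) (∏-^ k f xs)) (sym (^-distribʳ-* k (f x) (∏ f xs)))

∏-const : {A : Set} (c : ℕ) (xs : List A) → ∏ (λ _ → c) xs ≡ c ^ length xs
∏-const c [] = refl
∏-const c (x ∷ xs) = cong (c *_) (∏-const c xs)

∏-mono : {A : Set} {f g : A → ℕ} {xs : List A} → All (λ x → f x ≤ g x) xs → ∏ f xs ≤ ∏ g xs
∏-mono [] = ≤-refl
∏-mono (fx≤gx ∷ f≤g) = *-mono-≤ fx≤gx (∏-mono f≤g)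

∏≤^ : {A : Set} {f : A → ℕ} {c : ℕ} {xs : List A} → All (λ x → f x ≤ c) xs → ∏ f xs ≤ c ^ length xs
∏≤^ {c = c} {xs} f≤c = ≤-trans (∏-mono f≤c) (≤-reflexive (∏-const c xs))

-- The list is nonempty; on the empty list both sides would be 1.
∏<^ : {A : Set} {f : A → ℕ} {c : ℕ} {x : A} {xs : List A} →
  All (λ x → f x < c) (x ∷ xs) → ∏ f (x ∷ xs) < c ^ length (x ∷ xs)
∏<^ {f = f} {c} {x} {[]} (fx<c ∷ []) = subst₂ _<_ (sym (*-identityʳ (f x))) (sym (*-identityʳ c)) fx<c
∏<^ {xs = y ∷ xs} (fx<c ∷ f<c) = *-mono-< fx<c (∏<^ f<c)

∏-↭ : {A : Set} (f : A → ℕ) {xs ys : List A} → xs ↭ ys → ∏ f xs ≡ ∏ f ys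
∏-↭ f xs↭ys = product-↭ (↭-map⁺ f xs↭ys)

weight : {A : Set} → (A → A → ℕ) → List A → ℕ
weight s xs = product (edgeWeights s xs)

weight-∷ : {A : Set} (s : A → A → ℕ) (x : A) (xs : List A) → weight s (x ∷ xs) ≡ ∏ (s x) xs * weight s xs
weight-∷ s x xs = product-++ (map (s x) xs) (edgeWeights s xs)

weight-↭ : {A : Set} {s : A → A → ℕ} → (∀ x y → s x y ≡ s y x) → {xs ys : List A} →
  xs ↭ ys → weight s xs ≡ weight s ys
weight-↭ s-sym xs↭ys = product-↭ (edgeWeights-↭ s-sym xs↭ys)

weight-positive : {A : Set} {s : A → A → ℕ} → (∀ x y → 1 ≤ s x y) → (xs : List A) → 1 ≤ weight s xs
weight-positive s-pos [] = ≤-refl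
weight-positive {s = s} s-pos (x ∷ xs) rewrite weight-∷ s x xs =
  *-mono-≤ (≤-trans (≤-reflexive (sym (trans (∏-const 1 xs) (^-zeroˡ (length xs)))))
                    (∏-mono (All.universal (s-pos x) xs)))
           (weight-positive s-pos xs)

-- Every pair occurs in the degree products of both its ends. These also contain the diagonal
-- entries `s x x`, which are at least 1 and only enlarge the right side.
weight²≤∏∏ : {A : Set} {s : A → A → ℕ} → (∀ x y → s x y ≡ s y x) → (∀ x y → 1 ≤ s x y) → (xs : List A) →
  weight s xs * weight s xs ≤ ∏ (λ x → ∏ (s x) xs) xs
weight²≤∏∏ s-sym s-pos [] = ≤-refl
weight²≤∏∏ {s = s} s-sym s-pos (x ∷ xs) = begin
  weight s (x ∷ xs) * weight s (x ∷ xs)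
    ≡⟨ cong (λ p → p * p) (weight-∷ s x xs) ⟩
  r * w * (r * w)
    ≡⟨ square r w ⟩
  1 * r * (r * (w * w))
    ≤⟨ *-mono-≤ (*-monoˡ-≤ r (s-pos x x)) (*-monoʳ-≤ r (weight²≤∏∏ s-sym s-pos xs)) ⟩
  s x x * r * (r * ∏ (λ y → ∏ (s y) xs) xs)
    ≡⟨ cong (λ ys → s x x * r * (product ys * ∏ (λ y → ∏ (s y) xs) xs)) (map-cong (s-sym x) xs) ⟩
  s x x * r * (∏ (λ y → s y x) xs * ∏ (λ y → ∏ (s y) xs) xs)
    ≡⟨ cong (s x x * r *_) (∏-* (λ y → s y x) (λ y → ∏ (s y) xs) xs) ⟨
  ∏ (λ y → ∏ (s y) (x ∷ xs)) (x ∷ xs) ∎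
  where
  open ≤-Reasoning
  r = ∏ (s x) xs
  w = weight s xs
  square : ∀ r w → r * w * (r * w) ≡ 1 * r * (r * (w * w))
  square = solve-∀

-- Admissible multiplicities and blowups.

-- Vertices need not be distinct in these bounds, which makes them stable under cloning.
record Admissible {V : Set} (s : V → V → ℕ) : Set where
  field
    symmetric : ∀ x y → s x y ≡ s y x
    positive  : ∀ x y → 1 ≤ s x y
    edge≤3    : ∀ x y → s x y ≤ 3
    triple≤8  : ∀ x y z → sum (edgeWeights s (x ∷ y ∷ z ∷ [])) ≤ 8
    quad≤15   : ∀ x y z u → sum (edgeWeights s (x ∷ y ∷ z ∷ u ∷ [])) ≤ 15

-- Repetitions in the list of vertices are allowed: a repeated vertex v is a clone, joined to v with weight s v v.
record Blowup (n : ℕ) : Set₁ where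
  field
    V          : Set
    s          : V → V → ℕ
    admissible : Admissible s
    vertices   : List V
    size       : length vertices ≡ n
  open Admissible admissible public

  value : ℕ
  value = weight s vertices

  value-positive : 1 ≤ value
  value-positive = weight-positive positive vertices

open Blowup using (value; value-positive)

-- The explicit construction and a lower bound for its weight.

-- A near-extremal construction: about a quarter of the vertices have type true.
t : Bool → Bool → ℕ
t true  true  = 1
t false false = 2
t _     _     = 3

types : ℕ → List Bool
types (suc (suc (suc (suc n)))) = true ∷ false ∷ false ∷ false ∷ types n
types n = replicate n false

length-types : ∀ n → length (types n) ≡ n
length-types 0 = refl
length-types 1 = refl
length-types 2 = refl
length-types 3 = refl
length-types (suc (suc (suc (suc n)))) = cong (4 +_) (length-types n)

t-admissible : Admissible t
t-admissible = record
  { symmetric = λ where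
      true true → refl
      true false → refl
      false true → refl
      false false → refl
  ; positive = λ where
      true true → ≤ᵇ⇒≤ _ _ _
      true false → ≤ᵇ⇒≤ _ _ _
      false true → ≤ᵇ⇒≤ _ _ _
      false false → ≤ᵇ⇒≤ _ _ _
  ; edge≤3 = λ where
      true true → ≤ᵇ⇒≤ _ _ _
      true false → ≤ᵇ⇒≤ _ _ _
      false true → ≤ᵇ⇒≤ _ _ _
      false false → ≤ᵇ⇒≤ _ _ _
  -- All triples and quadruples of types, repetitions included, are decided by evaluation. Both
  -- bounds are attained with a single `true`: 3 + 3 + 2 = 8 and 9 + 6 = 15.
  ; triple≤8 = λ x y z → toWitness
      {a? = all-Bool? (λ x → all-Bool? (λ y → all-Bool? (λ z →
        sum (edgeWeights t (x ∷ y ∷ z ∷ [])) ≤? 8)))} _ x y z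
  ; quad≤15 = λ x y z u → toWitness
      {a? = all-Bool? (λ x → all-Bool? (λ y → all-Bool? (λ z → all-Bool? (λ u →
        sum (edgeWeights t (x ∷ y ∷ z ∷ u ∷ [])) ≤? 15))))} _ x y z u
  }
  where
  all-Bool? : {Q : Bool → Set} → (∀ b → Dec (Q b)) → Dec (∀ b → Q b)
  all-Bool? Q? = map′ (λ (f , g) → λ { true → f ; false → g }) (λ h → h true , h false) (Q? true ×-dec Q? false)

-- A block of four contributes 1 · 3³ = 27, and 27⁶ ≥ 100⁴; so the multiplicities at a vertex of
-- type `true` have geometric mean at least the cube root of 10.
types-true : ∀ n → 100 ^ n ≤ ∏ (t true) (types n) ^ 6
types-true 0 = ≤ᵇ⇒≤ _ _ _
types-true 1 = ≤ᵇ⇒≤ _ _ _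
types-true 2 = ≤ᵇ⇒≤ _ _ _
types-true 3 = ≤ᵇ⇒≤ _ _ _
types-true (suc (suc (suc (suc n)))) = begin
  100 ^ (4 + n)       ≡⟨ ^-distribˡ-+-* 100 4 n ⟩
  100 ^ 4 * 100 ^ n   ≤⟨ *-mono-≤ (≤ᵇ⇒≤ (100 ^ 4) (27 ^ 6) _) (types-true n) ⟩
  27 ^ 6 * d ^ 6      ≡⟨ ^-distribʳ-* 6 27 d ⟨
  (27 * d) ^ 6        ≡⟨ cong (_^ 6) (collect d) ⟩
  ∏ (t true) (types (4 + n)) ^ 6 ∎
  where
  open ≤-Reasoning
  d = ∏ (t true) (types n)
  collect : ∀ d → 27 * d ≡ 1 * (3 * (3 * (3 * d)))
  collect = solve-∀

-- A block of four contributes 3 · 2³ = 24, and 24⁶ ≥ 100⁴. The factor 4 covers up to three leftover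
-- vertices, which contribute only 2⁶ = 64 each.
types-false : ∀ n → 100 ^ n ≤ 4 * ∏ (t false) (types n) ^ 6
types-false 0 = ≤ᵇ⇒≤ _ _ _
types-false 1 = ≤ᵇ⇒≤ _ _ _
types-false 2 = ≤ᵇ⇒≤ _ _ _
types-false 3 = ≤ᵇ⇒≤ _ _ _
types-false (suc (suc (suc (suc n)))) = begin
  100 ^ (4 + n)           ≡⟨ ^-distribˡ-+-* 100 4 n ⟩
  100 ^ 4 * 100 ^ n       ≤⟨ *-mono-≤ (≤ᵇ⇒≤ (100 ^ 4) (24 ^ 6) _) (types-false n) ⟩
  24 ^ 6 * (4 * d ^ 6)    ≡⟨ exchange (24 ^ 6) 4 (d ^ 6) ⟩
  4 * (24 ^ 6 * d ^ 6)    ≡⟨ cong (4 *_) (^-distribʳ-* 6 24 d) ⟨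
  4 * (24 * d) ^ 6        ≡⟨ cong (λ e → 4 * e ^ 6) (collect d) ⟩
  4 * ∏ (t false) (types (4 + n)) ^ 6 ∎
  where
  open ≤-Reasoning
  d = ∏ (t false) (types n)
  collect : ∀ d → 24 * d ≡ 3 * (2 * (2 * (2 * d)))
  collect = solve-∀
  exchange : ∀ a b c → a * (b * c) ≡ b * (a * c)
  exchange = solve-∀

private
  exponent : ∀ b n → b ^ ((4 + n) * (4 + n)) ≡ b ^ (n * n) * (b ^ 16 * ((b ^ 2) ^ n) ^ 4)
  exponent b n = begin
    b ^ ((4 + n) * (4 + n))
      ≡⟨ cong (b ^_) (square n) ⟩
    b ^ (n * n + (16 + 2 * (n * 4)))
      ≡⟨ ^-distribˡ-+-* b (n * n) _ ⟩
    b ^ (n * n) * b ^ (16 + 2 * (n * 4))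
      ≡⟨ cong (b ^ (n * n) *_) (^-distribˡ-+-* b 16 (2 * (n * 4))) ⟩
    b ^ (n * n) * (b ^ 16 * b ^ (2 * (n * 4)))
      ≡⟨ cong (λ k → b ^ (n * n) * (b ^ 16 * k)) (trans (^-*-assoc (b ^ 2) n 4) (^-*-assoc b 2 (n * 4))) ⟨
    b ^ (n * n) * (b ^ 16 * ((b ^ 2) ^ n) ^ 4) ∎
    where
    open ≡-Reasoning
    square : ∀ n → (4 + n) * (4 + n) ≡ n * n + (16 + 2 * (n * 4))
    square = solve-∀

  -- The induction step of `types-weight` with its powers as letters: `m` is 10 to the n², `h` is
  -- 100ⁿ and `u` is 10¹⁶. A new block has inner weight `c` and is joined to the old vertices by `a`
  -- once (type `true`) and by `b` three times (type `false`), so the slack `d` of `b` enters cubed.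
  combine : ∀ {m} {h} {u} {v} c d e k a b w → m ≤ w ^ 6 * k → h ≤ a ^ 6 → h ≤ d * b ^ 6 → u * d ^ 3 ≤ c ^ 6 * e →
    v ≡ c * (a * (b ^ 3 * w)) → m * (u * h ^ 4) ≤ v ^ 6 * (e * k)
  combine {m} {h} {u} {v} c d e k a b w m≤ h≤a h≤b u≤ v≡ = begin
    m * (u * h ^ 4)
      ≤⟨ *-mono-≤ m≤ (*-monoʳ-≤ u (*-mono-≤ h≤a (^-monoˡ-≤ 3 h≤b))) ⟩
    w ^ 6 * k * (u * (a ^ 6 * (d * b ^ 6) ^ 3))
      ≡⟨ cong (λ x → w ^ 6 * k * (u * (a ^ 6 * x))) (^-distribʳ-* 3 d (b ^ 6)) ⟩
    w ^ 6 * k * (u * (a ^ 6 * (d ^ 3 * (b ^ 6) ^ 3)))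
      ≡⟨ gather (w ^ 6) k u (a ^ 6) (d ^ 3) ((b ^ 6) ^ 3) ⟩
    u * d ^ 3 * (w ^ 6 * k * a ^ 6 * (b ^ 6) ^ 3)
      ≤⟨ *-monoˡ-≤ _ u≤ ⟩
    c ^ 6 * e * (w ^ 6 * k * a ^ 6 * (b ^ 6) ^ 3)
      ≡⟨ cong (λ x → c ^ 6 * e * (w ^ 6 * k * a ^ 6 * x)) (trans (^-*-assoc b 6 3) (sym (^-*-assoc b 3 6))) ⟩
    c ^ 6 * e * (w ^ 6 * k * a ^ 6 * (b ^ 3) ^ 6)
      ≡⟨ scatter (c ^ 6) e (w ^ 6) k (a ^ 6) ((b ^ 3) ^ 6) ⟩
    c ^ 6 * (a ^ 6 * ((b ^ 3) ^ 6 * w ^ 6)) * (e * k)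
      ≡⟨ cong (_* (e * k)) sixth ⟨
    (c * (a * (b ^ 3 * w))) ^ 6 * (e * k)
      ≡⟨ cong (λ x → x ^ 6 * (e * k)) v≡ ⟨
    v ^ 6 * (e * k) ∎
    where
    open ≤-Reasoning
    gather : ∀ w k m a c b → w * k * (m * (a * (c * b))) ≡ m * c * (w * k * a * b)
    gather = solve-∀
    scatter : ∀ c d w k a b → c * d * (w * k * a * b) ≡ c * (a * (b * w)) * (d * k)
    scatter = solve-∀
    sixth : (c * (a * (b ^ 3 * w))) ^ 6 ≡ c ^ 6 * (a ^ 6 * ((b ^ 3) ^ 6 * w ^ 6))
    sixth = trans (^-distribʳ-* 6 c _) (cong (c ^ 6 *_)
      (trans (^-distribʳ-* 6 a _) (cong (a ^ 6 *_) (^-distribʳ-* 6 (b ^ 3) w))))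

-- Here (4 + n)² = n² + 16 + 8n, and a new block has inner weight 216 = 3³ · 2³. The factor `16 ^ n`
-- is nearly exhausted at n = 3, where the claim reads 10⁹ ≤ 2³⁰.
types-weight : ∀ n → 10 ^ (n * n) ≤ weight t (types n) ^ 6 * 16 ^ n
types-weight 0 = ≤ᵇ⇒≤ _ _ _
types-weight 1 = ≤ᵇ⇒≤ _ _ _
types-weight 2 = ≤ᵇ⇒≤ _ _ _
types-weight 3 = ≤ᵇ⇒≤ _ _ _
types-weight (suc (suc (suc (suc n)))) =
  subst₂ _≤_ (sym (exponent 10 n)) (cong (weight t (types (4 + n)) ^ 6 *_) (sym (^-distribˡ-+-* 16 4 n)))
    (combine {h = (10 ^ 2) ^ n} {u = 10 ^ 16} 216 4 (16 ^ 4) (16 ^ n) a b w (types-weight n) (types-true n) (types-false n)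
      (≤ᵇ⇒≤ (10 ^ 16 * 4 ^ 3) (216 ^ 6 * 16 ^ 4) _) (trans expand (collect a b w)))
  where
  a = ∏ (t true) (types n)
  b = ∏ (t false) (types n)
  w = weight t (types n)
  collect : ∀ a b w → 3 * (3 * (3 * a)) * (2 * (2 * b) * (2 * b * (b * w))) ≡ 216 * (a * (b * (b * (b * 1)) * w))
  collect = solve-∀
  expand : weight t (types (4 + n)) ≡ 3 * (3 * (3 * a)) * (2 * (2 * b) * (2 * b * (b * w)))
  expand = trans (weight-∷ t true (false ∷ false ∷ false ∷ types n)) (cong (3 * (3 * (3 * a)) *_)
    (trans (weight-∷ t false (false ∷ false ∷ types n)) (cong (2 * (2 * b) *_)
    (trans (weight-∷ t false (false ∷ types n)) (cong (2 * b *_) (weight-∷ t false (types n)))))))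

typesBlowup : ∀ n → Blowup n
typesBlowup n = record { admissible = t-admissible ; vertices = types n ; size = length-types n }

-- Growth of a blowup by cloning.

-- The product over all vertices of their degree products is at least value ², so some vertex is worth cloning.
clone : ∀ {n} .{{_ : NonZero n}} (B : Blowup n) → 10 ^ (n * n) ≤ value B ^ 6 * 16 ^ n →
  ∃ λ (B′ : Blowup (suc n)) → value B ^ 3 * 10 ^ n ≤ value B′ ^ 3 * 16
clone {n} B large with any? (λ v → 10 ^ n ≤? 16 * ∏ (Blowup.s B v) (Blowup.vertices B) ^ 3) (Blowup.vertices B)
... | yes rich with v , _ , v-rich ← find rich =
      record { admissible = admissible ; vertices = v ∷ vertices ; size = cong suc size } , (begin
        weight s vertices ^ 3 * 10 ^ n                    ≤⟨ *-monoʳ-≤ (weight s vertices ^ 3) v-rich ⟩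
        weight s vertices ^ 3 * (16 * deg v ^ 3)          ≡⟨ exchange (weight s vertices ^ 3) 16 (deg v ^ 3) ⟩
        deg v ^ 3 * weight s vertices ^ 3 * 16            ≡⟨ cong (_* 16) (^-distribʳ-* 3 (deg v) _) ⟨
        (deg v * weight s vertices) ^ 3 * 16              ≡⟨ cong (λ k → k ^ 3 * 16) (weight-∷ s v vertices) ⟨
        weight s (v ∷ vertices) ^ 3 * 16                  ∎)
  where
  open Blowup B
  open ≤-Reasoning
  deg = λ v → ∏ (s v) vertices
  exchange : ∀ a b c → a * (b * c) ≡ c * a * b
  exchange = solve-∀
... | no poor = contradiction large (<⇒≱ (begin-strict
    weight s vertices ^ 6 * 16 ^ n
      ≡⟨ cong (_* 16 ^ n) (trans (^-distribˡ-+-* (weight s vertices) 3 3) (sym (^-distribʳ-* 3 (weight s vertices) _))) ⟩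
    (weight s vertices * weight s vertices) ^ 3 * 16 ^ n
      ≤⟨ *-monoˡ-≤ (16 ^ n) (^-monoˡ-≤ 3 (weight²≤∏∏ symmetric positive vertices)) ⟩
    ∏ deg vertices ^ 3 * 16 ^ n
      ≡⟨ cong₂ _*_ (∏-^ 3 deg vertices) (trans (∏-const 16 vertices) (cong (16 ^_) size)) ⟨
    ∏ (λ v → deg v ^ 3) vertices * ∏ (λ _ → 16) vertices
      ≡⟨ *-comm (∏ (λ v → deg v ^ 3) vertices) _ ⟩
    ∏ (λ _ → 16) vertices * ∏ (λ v → deg v ^ 3) vertices
      ≡⟨ ∏-* (λ _ → 16) (λ v → deg v ^ 3) vertices ⟨
    ∏ (λ v → 16 * deg v ^ 3) vertices
      <⟨ bound vertices size (All.map ≰⇒> (All.¬Any⇒All¬ vertices poor)) ⟩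
    (10 ^ n) ^ n
      ≡⟨ ^-*-assoc 10 n n ⟩
    10 ^ (n * n) ∎))
  where
  open Blowup B
  open ≤-Reasoning
  deg = λ v → ∏ (s v) vertices
  bound : ∀ {n c} .{{_ : NonZero n}} {A : Set} {f : A → ℕ}
    (xs : List A) → length xs ≡ n → All (λ x → f x < c) xs → ∏ f xs < c ^ n
  bound (x ∷ xs) refl f<c = ∏<^ f<c

-- A blowup below the explicit construction is replaced by it before cloning; any other inherits its
-- lower bound, which is the hypothesis of `clone`.
grow : ∀ {n} .{{_ : NonZero n}} (B : Blowup n) →
  ∃ λ (B′ : Blowup (suc n)) → value B ^ 3 * 10 ^ n ≤ value B′ ^ 3 * 16
grow {n} B with ≤-total (value B) (weight t (types n))
... | inj₁ B≤W with B′ , le ← clone (typesBlowup n) (types-weight n) =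
  B′ , ≤-trans (*-monoˡ-≤ (10 ^ n) (^-monoˡ-≤ 3 B≤W)) le
... | inj₂ W≤B = clone B (≤-trans (types-weight n) (*-monoˡ-≤ (16 ^ n) (^-monoˡ-≤ 6 W≤B)))

private
  chain : ∀ {p q r g h h′ c d} → p * g ≤ q * c → h ≤ h′ → q * h′ ≤ r * d → p * (g * h) ≤ r * (d * c)
  chain {p} {q} {r} {g} {h} {h′} {c} {d} pg≤qc h≤h′ qh≤rd = begin
    p * (g * h)    ≡⟨ *-assoc p g h ⟨
    p * g * h      ≤⟨ *-mono-≤ pg≤qc h≤h′ ⟩
    q * c * h′     ≡⟨ exchange q c h′ ⟩
    q * h′ * c     ≤⟨ *-monoˡ-≤ c qh≤rd ⟩
    r * d * c      ≡⟨ *-assoc r d c ⟩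
    r * (d * c)    ∎
    where
    open ≤-Reasoning
    exchange : ∀ q c h → q * c * h ≡ q * h * c
    exchange = solve-∀

grow₂ : ∀ {n} .{{_ : NonZero n}} (B : Blowup n) →
  ∃ λ (B′ : Blowup (2 + n)) → value B ^ 3 * 100 ^ n ≤ value B′ ^ 3 * 256
grow₂ {n} B =
  let B₁ , le₁ = grow B
      B₂ , le₂ = grow B₁
  in B₂ , subst (λ k → value B ^ 3 * k ≤ value B₂ ^ 3 * 256) (sym (^-distribʳ-* n 10 10))
    (chain {p = value B ^ 3} {value B₁ ^ 3} {value B₂ ^ 3} {10 ^ n} {10 ^ n} {10 ^ (1 + n)} {16} {16}
      -- The second clone is made among n + 1 vertices; its gain is weakened to 10ⁿ.
      le₁ (^-monoʳ-≤ 10 (n≤1+n n)) le₂)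

grow₃ : ∀ {n} .{{_ : NonZero n}} (B : Blowup n) →
  ∃ λ (B′ : Blowup (3 + n)) → value B ^ 3 * 1000 ^ n ≤ value B′ ^ 3 * 4096
grow₃ {n} B =
  let B₂ , le₂ = grow₂ B
      B₃ , le₃ = grow B₂
  in B₃ , subst (λ k → value B ^ 3 * k ≤ value B₃ ^ 3 * 4096) (sym (^-distribʳ-* n 100 10))
    (chain {p = value B ^ 3} {value B₂ ^ 3} {value B₃ ^ 3} {100 ^ n} {10 ^ n} {10 ^ (2 + n)} {256} {16}
      le₂ (^-monoʳ-≤ 10 (m≤n+m n 2)) le₃)

-- Rearranging lists and bounding products with an exceptional factor.

Unique-resp-↭ : {A : Set} {xs ys : List A} → xs ↭ ys → Unique xs → Unique ys
Unique-resp-↭ {A} xs↭ys = ↭ₛ.Unique-resp-↭ (setoid A) (↭⇒↭ₛ xs↭ys)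

∈⇒↭∷ : {A : Set} {x : A} {xs : List A} → x ∈ xs → ∃ λ ys → xs ↭ x ∷ ys
∈⇒↭∷ {x = x} x∈xs with ys , zs , refl ← ∈-∃++ x∈xs = ys ++ zs , shift x ys zs

∈∷⇒∈ : {A : Set} {x y : A} {ys : List A} → x ≢ y → x ∈ y ∷ ys → x ∈ ys
∈∷⇒∈ x≢y (here x≡y) = contradiction x≡y x≢y
∈∷⇒∈ x≢y (there x∈ys) = x∈ys

↭-filters : {A : Set} {Q : A → Set} (Q? : Decidable Q) (xs : List A) →
  xs ↭ filter Q? xs ++ filter (λ x → ¬? (Q? x)) xs
↭-filters Q? [] = ↭-refl
↭-filters Q? (x ∷ xs) with does (Q? x)
... | true  = prep x (↭-filters Q? xs)
... | false = ↭-trans (prep x (↭-filters Q? xs)) (↭-sym (shift x (filter Q? xs) _))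

unique⇒allPairs : {A : Set} {R : A → A → Set} {xs : List A} → Unique xs →
  (∀ {x y} → x ∈ xs → y ∈ xs → x ≢ y → R x y) → AllPairs R xs
unique⇒allPairs [] r = []
unique⇒allPairs (x≢xs ∷ u) r =
  All.tabulate (λ y∈xs → r (here refl) (there y∈xs) (All.lookup x≢xs y∈xs)) ∷
  unique⇒allPairs u (λ x∈ y∈ → r (there x∈) (there y∈))

-- At most one entry satisfies `E`. Its factor is paid for by `c`, and the factor `g` standing in
-- its place is at least 1.
∏≤exceptional : {A : Set} {f g : A → ℕ} {E : A → Set} (E? : Decidable E) {c : ℕ} → 1 ≤ c → (∀ x → 1 ≤ g x) →
  {xs : List A} → All (λ x → E x → f x ≤ c) xs → All (λ x → ¬ E x → f x ≤ g x) xs →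
  AllPairs (λ x y → ¬ (E x × E y)) xs → ∏ f xs ≤ c * ∏ g xs
∏≤exceptional E? {c} 1≤c 1≤g [] [] [] = ≤-trans 1≤c (≤-reflexive (sym (*-identityʳ c)))
∏≤exceptional {f = f} {g} E? {c} 1≤c 1≤g {x ∷ xs} (f≤c ∷ fs≤c) (f≤g ∷ fs≤g) (¬Exy ∷ ¬Es) with E? x
... | yes Ex = *-mono-≤ (f≤c Ex)
                 (≤-trans (∏-mono (All.zipWith (λ (f≤g , ¬Exy) → f≤g (λ Ey → ¬Exy (Ex , Ey))) (fs≤g , ¬Exy)))
                          (≤-trans (≤-reflexive (sym (*-identityˡ (∏ g xs)))) (*-monoˡ-≤ (∏ g xs) (1≤g x))))
... | no ¬Ex = ≤-trans (*-mono-≤ (f≤g ¬Ex) (∏≤exceptional E? 1≤c 1≤g fs≤c fs≤g ¬Es)) (≤-reflexive (exchange (g x) c (∏ g xs)))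
  where
  exchange : ∀ a b c → a * (b * c) ≡ b * (a * c)
  exchange = solve-∀

∏-++ : {A : Set} (f : A → ℕ) (xs ys : List A) → ∏ f (xs ++ ys) ≡ ∏ f xs * ∏ f ys
∏-++ f xs ys = trans (cong product (map-++ f xs ys)) (product-++ (map f xs) (map f ys))

weight≤^ : {A : Set} {s : A → A → ℕ} {c : ℕ} → 1 ≤ c → (∀ x y → s x y ≤ c) → (xs : List A) →
  weight s xs ≤ c ^ (length xs * length xs)
weight≤^ 1≤c s≤c [] = ≤-refl
weight≤^ {s = s} {c} 1≤c s≤c (x ∷ xs) = begin
  weight s (x ∷ xs)            ≡⟨ weight-∷ s x xs ⟩
  ∏ (s x) xs * weight s xs     ≤⟨ *-mono-≤ (∏≤^ (All.universal (s≤c x) xs)) (weight≤^ 1≤c s≤c xs) ⟩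
  c ^ n * c ^ (n * n)          ≡⟨ ^-distribˡ-+-* c n (n * n) ⟨
  c ^ (n + n * n)              ≤⟨ ^-monoʳ-≤ c {{>-nonZero 1≤c}} (+-mono-≤ (n≤1+n n) (*-monoʳ-≤ n (n≤1+n n))) ⟩
  c ^ (suc n + n * suc n)      ∎
  where
  open ≤-Reasoning
  n = length xs

-- Numerical inequalities for deletion costs and cloning gains.

private
  -- Both numbers are at most `k`, so finitely many cases remain; the implicit argument is their
  -- decision by evaluation.
  product₂≤ : ∀ k c {_ : True (allUpTo? (λ a → allUpTo? (λ b → a + b ≤? k →-dec a * b ≤? c) (suc k)) (suc k))} →
    ∀ {a b} → a + b ≤ k → a * b ≤ c
  product₂≤ k c {check} {a} {b} a+b≤k =
    toWitness check (s≤s (m+n≤o⇒m≤o a a+b≤k)) (s≤s (m+n≤o⇒n≤o a a+b≤k)) a+b≤k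

  product₃≤ : ∀ {a b c} → a + (b + c) ≤ 6 → a * (b * c) ≤ 8
  product₃≤ {a} {b} {c} abc≤6 = toWitness
    {a? = allUpTo? (λ a → allUpTo? (λ b → allUpTo? (λ c → a + (b + c) ≤? 6 →-dec a * (b * c) ≤? 8) 7) 7) 7} _
    (s≤s (m+n≤o⇒m≤o a abc≤6)) (s≤s (m+n≤o⇒m≤o b bc≤6)) (s≤s (m+n≤o⇒n≤o b bc≤6)) abc≤6
    where bc≤6 = m+n≤o⇒n≤o a abc≤6

  ^-comm : ∀ b m n → (b ^ m) ^ n ≡ (b ^ n) ^ m
  ^-comm b m n = trans (^-*-assoc b m n) (trans (cong (b ^_) (*-comm m n)) (sym (^-*-assoc b n m)))

  -- Since 6 · 4 · 4 = 96, equality holds at β = 2α, in the form 216 · 64² = 96³. Each further 4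
  -- contributes 64 ≤ 96 to the cube.
  few-light : ∀ {α β} → α + α ≤ β → (6 ^ α * 4 ^ β) ^ 3 ≤ 96 ^ (α + β)
  few-light {α} {β} 2α≤β = begin
    (6 ^ α * 4 ^ β) ^ 3                       ≡⟨ ^-distribʳ-* 3 (6 ^ α) (4 ^ β) ⟩
    (6 ^ α) ^ 3 * (4 ^ β) ^ 3                 ≡⟨ cong₂ _*_ (^-comm 6 α 3) (^-comm 4 β 3) ⟩
    216 ^ α * 64 ^ β                          ≡⟨ cong (λ k → 216 ^ α * 64 ^ k) β≡ ⟩
    216 ^ α * 64 ^ (α + α + r)                ≡⟨ cong (216 ^ α *_) (split 64 α r) ⟩
    216 ^ α * ((64 * 64) ^ α * 64 ^ r)        ≡⟨ *-assoc (216 ^ α) ((64 * 64) ^ α) (64 ^ r) ⟨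
    216 ^ α * (64 * 64) ^ α * 64 ^ r          ≡⟨ cong (_* 64 ^ r) (^-distribʳ-* α 216 (64 * 64)) ⟨
    (96 * (96 * 96)) ^ α * 64 ^ r             ≤⟨ *-monoʳ-≤ ((96 * (96 * 96)) ^ α) (^-monoˡ-≤ r (≤ᵇ⇒≤ 64 96 _)) ⟩
    (96 * (96 * 96)) ^ α * 96 ^ r             ≡⟨ cong (_* 96 ^ r) (^-distribʳ-* α 96 (96 * 96)) ⟩
    96 ^ α * (96 * 96) ^ α * 96 ^ r           ≡⟨ *-assoc (96 ^ α) ((96 * 96) ^ α) (96 ^ r) ⟩
    96 ^ α * ((96 * 96) ^ α * 96 ^ r)         ≡⟨ cong (96 ^ α *_) (split 96 α r) ⟨
    96 ^ α * 96 ^ (α + α + r)                 ≡⟨ ^-distribˡ-+-* 96 α (α + α + r) ⟨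
    96 ^ (α + (α + α + r))                    ≡⟨ cong (λ k → 96 ^ (α + k)) β≡ ⟨
    96 ^ (α + β)                              ∎
    where
    open ≤-Reasoning
    r = β ∸ (α + α)
    β≡ : β ≡ α + α + r
    β≡ = sym (m+[n∸m]≡n 2α≤β)
    split : ∀ b α r → b ^ (α + α + r) ≡ (b * b) ^ α * b ^ r
    split b α r = trans (^-distribˡ-+-* b (α + α) r)
      (cong (_* b ^ r) (trans (^-distribˡ-+-* b α α) (sym (^-distribʳ-* α b b))))

  -- Now α + β is at least 3β/2, and 9⁶ ≤ 96³ because 81 ≤ 96. Squaring clears the half.
  many-light : ∀ {α β} → β ≤ α + α → (9 ^ β) ^ 3 ≤ 96 ^ (α + β)
  many-light {α} {β} β≤2α = ^-cancelˡ-≤ 2 (begin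
    ((9 ^ β) ^ 3) ^ 2        ≡⟨ ^-*-assoc (9 ^ β) 3 2 ⟩
    (9 ^ β) ^ 6              ≡⟨ ^-comm 9 β 6 ⟩
    (9 ^ 6) ^ β              ≤⟨ ^-monoˡ-≤ β (≤ᵇ⇒≤ (9 ^ 6) (96 ^ 3) _) ⟩
    (96 ^ 3) ^ β             ≡⟨ ^-*-assoc 96 3 β ⟩
    96 ^ (3 * β)             ≤⟨ ^-monoʳ-≤ 96 le ⟩
    96 ^ ((α + β) * 2)       ≡⟨ ^-*-assoc 96 (α + β) 2 ⟨
    (96 ^ (α + β)) ^ 2       ∎)
    where
    open ≤-Reasoning
    left : ∀ β → 3 * β ≡ β + (β + β)
    left = solve-∀
    right : ∀ α β → α + α + (β + β) ≡ (α + β) * 2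
    right = solve-∀
    le : 3 * β ≤ (α + β) * 2
    le = ≤-trans (≤-reflexive (left β)) (≤-trans (+-monoˡ-≤ (β + β) β≤2α) (≤-reflexive (right α β)))

  cubed : ∀ {f c p n} → f ≤ c * p → p ^ 3 ≤ 96 ^ n → f ^ 3 ≤ 96 ^ n * c ^ 3
  cubed {f} {c} {p} {n} f≤cp p³≤ = begin
    f ^ 3            ≤⟨ ^-monoˡ-≤ 3 f≤cp ⟩
    (c * p) ^ 3      ≡⟨ ^-distribʳ-* 3 c p ⟩
    c ^ 3 * p ^ 3    ≤⟨ *-monoʳ-≤ (c ^ 3) p³≤ ⟩
    c ^ 3 * 96 ^ n   ≡⟨ *-comm (c ^ 3) (96 ^ n) ⟩
    96 ^ n * c ^ 3   ∎
    where open ≤-Reasoning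

  -- Deletion costs the factor `f`, with cube at most `r ^ m * C`; cloning gains at least
  -- `R ^ m / c` in the cube. Once `R ^ m` exceeds `r ^ m` times all constants, a factor `a` is left
  -- over, whatever the factor `T` relating the remaining graph to its blowup.
  absorb : ∀ {a C c r R f w b b⁺} .{{_ : NonZero R}} m → f ^ 3 ≤ r ^ m * C → b ^ 3 * R ^ m ≤ b⁺ ^ 3 * c →
    r ^ m * (a ^ 3 * C * c) ≤ R ^ m → ∀ T → w ≤ T * b → a * (f * w) ≤ T * b⁺
  absorb {a} {C} {c} {r} {R} {f} {w} {b} {b⁺} m f≤ b≤ r≤R T w≤ =
    ^-cancelˡ-≤ 3 (*-cancelʳ-≤ _ _ (R ^ m) {{m^n≢0 R m}} (begin
      (a * (f * w)) ^ 3 * R ^ m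
        ≡⟨ cong (_* R ^ m) (trans (^-distribʳ-* 3 a (f * w)) (cong (a ^ 3 *_) (^-distribʳ-* 3 f w))) ⟩
      a ^ 3 * (f ^ 3 * w ^ 3) * R ^ m
        ≤⟨ *-monoˡ-≤ (R ^ m) (*-monoʳ-≤ (a ^ 3) (*-mono-≤ f≤ (^-monoˡ-≤ 3 w≤))) ⟩
      a ^ 3 * (r ^ m * C * (T * b) ^ 3) * R ^ m
        ≡⟨ cong (λ k → a ^ 3 * (r ^ m * C * k) * R ^ m) (^-distribʳ-* 3 T b) ⟩
      a ^ 3 * (r ^ m * C * (T ^ 3 * b ^ 3)) * R ^ m
        ≡⟨ gather (a ^ 3) (r ^ m) C (T ^ 3) (b ^ 3) (R ^ m) ⟩
      a ^ 3 * (r ^ m * C * T ^ 3) * (b ^ 3 * R ^ m)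
        ≤⟨ *-monoʳ-≤ (a ^ 3 * (r ^ m * C * T ^ 3)) b≤ ⟩
      a ^ 3 * (r ^ m * C * T ^ 3) * (b⁺ ^ 3 * c)
        ≡⟨ scatter (a ^ 3) (r ^ m) C (T ^ 3) (b⁺ ^ 3) c ⟩
      r ^ m * (a ^ 3 * C * c) * (T ^ 3 * b⁺ ^ 3)
        ≤⟨ *-monoˡ-≤ (T ^ 3 * b⁺ ^ 3) r≤R ⟩
      R ^ m * (T ^ 3 * b⁺ ^ 3)
        ≡⟨ cong (R ^ m *_) (^-distribʳ-* 3 T b⁺) ⟨
      R ^ m * (T * b⁺) ^ 3
        ≡⟨ *-comm (R ^ m) _ ⟩
      (T * b⁺) ^ 3 * R ^ m ∎))
    where
    open ≤-Reasoning
    gather : ∀ a r C T b R → a * (r * C * (T * b)) * R ≡ a * (r * C * T) * (b * R)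
    gather = solve-∀
    scatter : ∀ a r C T b c → a * (r * C * T) * (b * c) ≡ r * (a * C * c) * (T * b)
    scatter = solve-∀

  geometric : ∀ {K r R n₀ m} → r ^ n₀ * K ≤ R ^ n₀ → r ≤ R → n₀ ≤ m → r ^ m * K ≤ R ^ m
  geometric {K} {r} {R} {n₀} {m} base r≤R n₀≤m = begin
    r ^ m * K                ≡⟨ cong (λ k → r ^ k * K) m≡ ⟩
    r ^ (n₀ + d) * K         ≡⟨ cong (_* K) (^-distribˡ-+-* r n₀ d) ⟩
    r ^ n₀ * r ^ d * K       ≡⟨ exchange (r ^ n₀) (r ^ d) K ⟩
    r ^ n₀ * K * r ^ d       ≤⟨ *-mono-≤ base (^-monoˡ-≤ d r≤R) ⟩
    R ^ n₀ * R ^ d           ≡⟨ ^-distribˡ-+-* R n₀ d ⟨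
    R ^ (n₀ + d)             ≡⟨ cong (R ^_) m≡ ⟨
    R ^ m                    ∎
    where
    open ≤-Reasoning
    d = m ∸ n₀
    m≡ : m ≡ n₀ + d
    m≡ = sym (m+[n∸m]≡n n₀≤m)
    exchange : ∀ a b c → a * b * c ≡ a * c * b
    exchange = solve-∀

  -- The constant collects the desired gain 16, the cost 273375 of a light pair (both cubed), and
  -- the loss 256 of `grow₂`. The inequality sets in near m = 1260; 1300 serves both reductions.
  ratio₂ : ∀ {m} → 1300 ≤ m → 96 ^ m * (16 ^ 3 * 273375 ^ 3 * 256) ≤ 100 ^ m
  ratio₂ = geometric {16 ^ 3 * 273375 ^ 3 * 256} {96} {100} {1300}
    (≤ᵇ⇒≤ (96 ^ 1300 * (16 ^ 3 * 273375 ^ 3 * 256)) (100 ^ 1300) _) (≤ᵇ⇒≤ 96 100 _)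

  ratio₃ : ∀ {m} → 1300 ≤ m → 512 ^ m * (16 ^ 3 * 3375 ^ 3 * 4096) ≤ 1000 ^ m
  ratio₃ = geometric {16 ^ 3 * 3375 ^ 3 * 4096} {512} {1000} {1300}
    (≤ᵇ⇒≤ (512 ^ 1300 * (16 ^ 3 * 3375 ^ 3 * 4096)) (1000 ^ 1300) _) (≤ᵇ⇒≤ 512 1000 _)

-- Multiplicity functions and the factors split off with deleted vertices.

-- The diagonal value 1 is the multiplicity between a vertex and its clone.
record MultiplicityFunction (V : Set) : Set where
  field
    _≟_       : DecidableEquality V
    s         : V → V → ℕ
    symmetric : ∀ x y → s x y ≡ s y x
    diagonal  : ∀ x → s x x ≡ 1
    positive  : ∀ x y → 1 ≤ s x y
    edge≤15   : ∀ x y → s x y ≤ 15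
    quad≤15   : ∀ {x y z u} → Unique (x ∷ y ∷ z ∷ u ∷ []) → sum (edgeWeights s (x ∷ y ∷ z ∷ u ∷ [])) ≤ 15

module _ {V : Set} (G : MultiplicityFunction V) where
  open MultiplicityFunction G

  -- The six edges grouped as `x y`, the two edges from `z`, the two edges from `u`, and `z u`: the
  -- shape in which lower bounds contradict 15.
  quad-bound : ∀ {x y z u a b c d} → Unique (x ∷ y ∷ z ∷ u ∷ []) →
    a ≤ s x y → b ≤ s x z + s y z → c ≤ s x u + s y u → d ≤ s z u → a + (b + (c + d)) ≤ 15
  quad-bound {x} {y} {z} {u} distinct a≤ b≤ c≤ d≤ =
    ≤-trans (+-mono-≤ a≤ (+-mono-≤ b≤ (+-mono-≤ c≤ d≤)))
      (≤-trans (≤-reflexive (regroup (s x y) (s x z) (s x u) (s y z) (s y u) (s z u))) (quad≤15 distinct))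
    where
    regroup : ∀ a b c d e f → a + (b + d + (c + e + f)) ≡ a + (b + (c + (d + (e + (f + 0)))))
    regroup = solve-∀

  -- Multiplicative: the factor of the weight that is lost at `z` when `x` and `y` are deleted.
  codegree : V → V → V → ℕ
  codegree x y z = s x z * s y z

  codegree≤225 : ∀ x y z → codegree x y z ≤ 225
  codegree≤225 x y z = *-mono-≤ (edge≤15 x z) (edge≤15 y z)

  weight-∷∷ : ∀ x y M → weight s (x ∷ y ∷ M) ≡ s x y * ∏ (codegree x y) M * weight s M
  weight-∷∷ x y M = begin
    weight s (x ∷ y ∷ M)
      ≡⟨ trans (weight-∷ s x (y ∷ M)) (cong (∏ (s x) (y ∷ M) *_) (weight-∷ s y M)) ⟩
    s x y * ∏ (s x) M * (∏ (s y) M * weight s M)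
      ≡⟨ regroup (s x y) (∏ (s x) M) (∏ (s y) M) (weight s M) ⟩
    s x y * (∏ (s x) M * ∏ (s y) M) * weight s M
      ≡⟨ cong (λ k → s x y * k * weight s M) (∏-* (s x) (s y) M) ⟨
    s x y * ∏ (codegree x y) M * weight s M ∎
    where
    open ≡-Reasoning
    regroup : ∀ a b c d → a * b * (c * d) ≡ a * (b * c) * d
    regroup = solve-∀

  weight-∷∷∷ : ∀ x y z M → weight s (x ∷ y ∷ z ∷ M) ≡
    s x y * s x z * s y z * ∏ (λ u → s x u * (s y u * s z u)) M * weight s M
  weight-∷∷∷ x y z M = begin
    weight s (x ∷ y ∷ z ∷ M)
      ≡⟨ trans (weight-∷ s x (y ∷ z ∷ M)) (cong (∏ (s x) (y ∷ z ∷ M) *_)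
          (trans (weight-∷ s y (z ∷ M)) (cong (∏ (s y) (z ∷ M) *_) (weight-∷ s z M)))) ⟩
    s x y * (s x z * X) * (s y z * Y * (Z * W))
      ≡⟨ regroup (s x y) (s x z) X (s y z) Y Z W ⟩
    s x y * s x z * s y z * (X * (Y * Z)) * W
      ≡⟨ cong (λ k → s x y * s x z * s y z * k * W)
           (trans (∏-* (s x) (λ u → s y u * s z u) M) (cong (X *_) (∏-* (s y) (s z) M))) ⟨
    s x y * s x z * s y z * ∏ (λ u → s x u * (s y u * s z u)) M * W ∎
    where
    open ≡-Reasoning
    X = ∏ (s x) M
    Y = ∏ (s y) M
    Z = ∏ (s z) M
    W = weight s M
    regroup : ∀ a b X c Y Z W → a * (b * X) * (c * Y * (Z * W)) ≡ a * b * c * (X * (Y * Z)) * W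
    regroup = solve-∀

  -- A pair near a heavy edge that is cheap to delete.

  -- 273375 = 15 · 225 · 9², from the pair itself, one exceptional vertex, and x and y when p and q lie in A.
  record LightPair (L : List V) : Set where
    field
      {p q} : V
      rest  : List V
      perm  : L ↭ p ∷ q ∷ rest
      light : (s p q * ∏ (codegree p q) rest) ^ 3 ≤ 96 ^ length rest * 273375 ^ 3

  -- The two choices of the pair meet at |B| = 2|A|. Per three vertices, one in `A` and two in `B`,
  -- deleting `x` and `y` costs 6 · 4² = 96, and deleting two vertices of `A` costs 9² = 81, up to
  -- constants.
  heavyEdge⇒lightPair : ∀ x y M → Unique (x ∷ y ∷ M) → 4 ≤ s x y → 3 ≤ length M → LightPair (x ∷ y ∷ M)
  heavyEdge⇒lightPair x y M distinct@((x≢y ∷ x≢M) ∷ y≢M ∷ M-distinct) 4≤sxy 3≤M = pick A refl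
    where
    a : V → ℕ
    a z = s x z + s y z

    heavy? : Decidable (λ z → 5 ≤ a z)
    heavy? z = 5 ≤? a z

    A B : List V
    A = filter heavy? M
    B = filter (λ z → ¬? (heavy? z)) M

    M↭A++B : M ↭ A ++ B
    M↭A++B = ↭-filters heavy? M

    |M| : length M ≡ length A + length B
    |M| = trans (↭-length M↭A++B) (length-++ A)

    A-heavy : All (λ z → 5 ≤ a z) A
    A-heavy = All.all-filter heavy? M

    B-light : All (λ z → ¬ 5 ≤ a z) B
    B-light = All.all-filter (λ z → ¬? (heavy? z)) M

    xyzz′ : ∀ {z z′} → z ∈ M → z′ ∈ M → z ≢ z′ → Unique (x ∷ y ∷ z ∷ z′ ∷ [])
    xyzz′ z∈M z′∈M z≢z′ = (x≢y ∷ All.lookup x≢M z∈M ∷ All.lookup x≢M z′∈M ∷ [])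
      ∷ (All.lookup y≢M z∈M ∷ All.lookup y≢M z′∈M ∷ []) ∷ (z≢z′ ∷ []) ∷ [] ∷ []

    few : length A + length A ≤ length B → LightPair (x ∷ y ∷ M)
    few 2A≤B = record
      { rest = M ; perm = ↭-refl
      ; light = cubed {c = 273375} {6 ^ length A * 4 ^ length B} {length M} bound power
      }
      where
      bound-of : ∀ {z} → Dec (5 ≤ a z) → ℕ
      bound-of (yes _) = 6
      bound-of (no _)  = 4

      g : V → ℕ
      g z = bound-of (heavy? z)

      1≤g : ∀ z → 1 ≤ g z
      1≤g z with heavy? z
      ... | yes _ = s≤s z≤n
      ... | no _  = s≤s z≤n

      g≤6 : ∀ z → g z ≤ 6
      g≤6 z with heavy? z
      ... | yes _ = ≤-refl
      ... | no _  = ≤ᵇ⇒≤ 4 6 _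

      g≤4 : ∀ {z} → ¬ 5 ≤ a z → g z ≤ 4
      g≤4 {z} ¬h with heavy? z
      ... | yes h = contradiction h ¬h
      ... | no _  = ≤-refl

      codegree≤g : ∀ z → ¬ 6 ≤ a z → codegree x y z ≤ g z
      codegree≤g z ¬6≤a with heavy? z
      ... | yes _   = product₂≤ 5 6 {_} {s x z} {s y z} (≤-pred (≰⇒> ¬6≤a))
      ... | no ¬5≤a = product₂≤ 4 4 {_} {s x z} {s y z} (≤-pred (≰⇒> ¬5≤a))

      -- Two such vertices would give 4 + 6 + 6 + 1 = 17, so at most one factor has to be bounded by
      -- 225.
      not-both : AllPairs (λ z z′ → ¬ (6 ≤ a z × 6 ≤ a z′)) M
      not-both = unique⇒allPairs M-distinct λ z∈M z′∈M z≢z′ (6≤a , 6≤a′) →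
        from-no (17 ≤? 15) (quad-bound (xyzz′ z∈M z′∈M z≢z′) 4≤sxy 6≤a 6≤a′ (positive _ _))

      ∏g : ∏ g M ≤ 6 ^ length A * 4 ^ length B
      ∏g = begin
        ∏ g M                         ≡⟨ trans (∏-↭ g M↭A++B) (∏-++ g A B) ⟩
        ∏ g A * ∏ g B                 ≤⟨ *-mono-≤ (∏≤^ (All.universal g≤6 A)) (∏≤^ (All.map g≤4 B-light)) ⟩
        6 ^ length A * 4 ^ length B   ∎
        where open ≤-Reasoning

      bound : s x y * ∏ (codegree x y) M ≤ 273375 * (6 ^ length A * 4 ^ length B)
      bound = begin
        s x y * ∏ (codegree x y) M
          ≤⟨ *-mono-≤ (edge≤15 x y) (∏≤exceptional (λ z → 6 ≤? a z) (≤ᵇ⇒≤ 1 225 _) 1≤g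
               (All.universal (λ z _ → codegree≤225 x y z) M) (All.universal codegree≤g M) not-both) ⟩
        15 * (225 * ∏ g M)
          ≡⟨ *-assoc 15 225 (∏ g M) ⟨
        15 * 225 * ∏ g M
          -- The constant is enlarged to the one of the case `many`, so that both cases fit one
          -- record.
          ≤⟨ *-mono-≤ (≤ᵇ⇒≤ (15 * 225) 273375 _) ∏g ⟩
        273375 * (6 ^ length A * 4 ^ length B) ∎
        where open ≤-Reasoning

      power : (6 ^ length A * 4 ^ length B) ^ 3 ≤ 96 ^ length M
      power = ≤-trans (few-light {length A} 2A≤B) (≤-reflexive (cong (96 ^_) (sym |M|)))

    many : ∀ {u v A′} → A ≡ u ∷ v ∷ A′ → length B ≤ length A′ + length A′ + 3 → LightPair (x ∷ y ∷ M)
    many {u} {v} {A′} A≡ B≤ = record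
      { rest = rest ; perm = perm ; light = cubed {c = 273375} {9 ^ length B} {length rest} bound power }
      where
      rest : List V
      rest = A′ ++ x ∷ y ∷ B

      M↭ : M ↭ u ∷ v ∷ A′ ++ B
      M↭ = ↭-trans M↭A++B (↭-reflexive (cong (_++ B) A≡))

      perm : x ∷ y ∷ M ↭ u ∷ v ∷ rest
      perm = ↭-trans (prep x (prep y M↭)) (shifts (x ∷ y ∷ []) (u ∷ v ∷ A′))

      A⊆M : ∀ {z} → z ∈ u ∷ v ∷ A′ → z ∈ M
      A⊆M z∈ = ∈-resp-↭ (↭-sym M↭) (∈-++⁺ˡ z∈)

      heavy : All (λ z → 5 ≤ a z) (u ∷ v ∷ A′)
      heavy = subst (All _) A≡ A-heavy

      uv-distinct : Unique (u ∷ v ∷ rest)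
      uv-distinct = Unique-resp-↭ perm distinct

      A-distinct : Unique (u ∷ v ∷ A′)
      A-distinct = subst Unique A≡ (Unique.filter⁺ heavy? M-distinct)

      -- A multiplicity of 2 inside `A` would give 4 + 5 + 5 + 2 = 16.
      A-light : ∀ {z z′} → z ∈ u ∷ v ∷ A′ → z′ ∈ u ∷ v ∷ A′ → z ≢ z′ → s z z′ ≤ 1
      A-light z∈ z′∈ z≢z′ = ≤-pred (≰⇒> λ 2≤s → from-no (16 ≤? 15)
        (quad-bound (xyzz′ (A⊆M z∈) (A⊆M z′∈) z≢z′) 4≤sxy (All.lookup heavy z∈) (All.lookup heavy z′∈) 2≤s))

      h : V → ℕ
      h = codegree u v

      inside : All (λ z → h z ≤ 1) A′
      inside with (_ ∷ u≢A′) ∷ v≢A′ ∷ _ ← A-distinct = All.tabulate λ z∈ →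
        *-mono-≤ (A-light (here refl) (there (there z∈)) (All.lookup u≢A′ z∈))
                 (A-light (there (here refl)) (there (there z∈)) (All.lookup v≢A′ z∈))

      outside-distinct : Unique (x ∷ y ∷ B)
      outside-distinct with _ ∷ _ ∷ r ← uv-distinct = drop-++ A′ r
        where
        drop-++ : ∀ xs {ys} → Unique (xs ++ ys) → Unique ys
        drop-++ [] u = u
        drop-++ (x ∷ xs) (_ ∷ u) = drop-++ xs u

      -- Two vertices sending 7 to `u` and `v` would give 1 + 7 + 7 + 1 = 16. All others send at
      -- most 6, with product at most 9.
      not-both : AllPairs (λ z z′ → ¬ (7 ≤ s u z + s v z × 7 ≤ s u z′ + s v z′)) (x ∷ y ∷ B)
      not-both with (u≢v ∷ u≢) ∷ v≢ ∷ _ ← uv-distinct = unique⇒allPairs outside-distinct λ z∈ z′∈ z≢z′ (7≤ , 7≤′) →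
        from-no (16 ≤? 15) (quad-bound
          ((u≢v ∷ All.lookup (All.++⁻ʳ A′ u≢) z∈ ∷ All.lookup (All.++⁻ʳ A′ u≢) z′∈ ∷ []) ∷
           (All.lookup (All.++⁻ʳ A′ v≢) z∈ ∷ All.lookup (All.++⁻ʳ A′ v≢) z′∈ ∷ []) ∷ (z≢z′ ∷ []) ∷ [] ∷ [])
          (positive u v) 7≤ 7≤′ (positive _ _))

      outside : ∏ h (x ∷ y ∷ B) ≤ 225 * 9 ^ (2 + length B)
      outside = ≤-trans
        (∏≤exceptional {g = λ _ → 9} (λ z → 7 ≤? s u z + s v z) (≤ᵇ⇒≤ 1 225 _) (λ _ → s≤s z≤n)
          (All.universal (λ z _ → codegree≤225 u v z) (x ∷ y ∷ B))
          (All.universal (λ z ¬7≤ → product₂≤ 6 9 {_} {s u z} {s v z} (≤-pred (≰⇒> ¬7≤))) (x ∷ y ∷ B)) not-both)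
        (≤-reflexive (cong (225 *_) (∏-const 9 (x ∷ y ∷ B))))

      regroup : ∀ b → 15 * (1 * (225 * (81 * b))) ≡ 273375 * b
      regroup b = begin
        15 * (1 * (225 * (81 * b))) ≡⟨ cong (15 *_) (*-identityˡ (225 * (81 * b))) ⟩
        15 * (225 * (81 * b))       ≡⟨ cong (15 *_) (*-assoc 225 81 b) ⟨
        15 * (225 * 81 * b)         ≡⟨ *-assoc 15 (225 * 81) b ⟨
        15 * (225 * 81) * b         ∎
        where open ≡-Reasoning

      bound : s u v * ∏ h rest ≤ 273375 * 9 ^ length B
      bound = begin
        s u v * ∏ h rest
          ≡⟨ cong (s u v *_) (∏-++ h A′ (x ∷ y ∷ B)) ⟩
        s u v * (∏ h A′ * ∏ h (x ∷ y ∷ B))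
          ≤⟨ *-mono-≤ (edge≤15 u v) (*-mono-≤ (≤-trans (∏≤^ inside) (≤-reflexive (^-zeroˡ (length A′)))) outside) ⟩
        15 * (1 * (225 * 9 ^ (2 + length B)))
          ≡⟨ cong (λ k → 15 * (1 * (225 * k))) (^-distribˡ-+-* 9 2 (length B)) ⟩
        15 * (1 * (225 * (81 * 9 ^ length B)))
          ≡⟨ regroup (9 ^ length B) ⟩
        273375 * 9 ^ length B ∎
        where open ≤-Reasoning

      |rest| : length rest ≡ 2 + length A′ + length B
      |rest| = trans (length-++ A′) (regroup′ (length A′) (length B))
        where
        regroup′ : ∀ α β → α + (2 + β) ≡ 2 + α + β
        regroup′ = solve-∀

      -- In the count, `x` and `y` stand in for the deleted `u` and `v`, so α = 2 + |A′|, and |B| ≤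
      -- 2|A′| + 3 < 2α.
      power : (9 ^ length B) ^ 3 ≤ 96 ^ length rest
      power = ≤-trans (many-light {2 + length A′} {length B}
        (≤-trans B≤ (≤-trans (+-monoʳ-≤ _ (≤ᵇ⇒≤ 3 4 _)) (≤-reflexive (regroup′ (length A′))))))
        (≤-reflexive (cong (96 ^_) (sym |rest|)))
        where
        regroup′ : ∀ α → α + α + 4 ≡ 2 + α + (2 + α)
        regroup′ = solve-∀

    pick : ∀ A₀ → A ≡ A₀ → LightPair (x ∷ y ∷ M)
    pick A₀ A≡ with length A + length A ≤? length B
    pick A₀ A≡ | yes 2A≤B = few 2A≤B
    pick (u ∷ v ∷ A′) A≡ | no 2A≰B = many A≡ (≤-pred (subst (length B <_) regroup (≰⇒> 2A≰B)))
      where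
      double : ∀ α → 2 + α + (2 + α) ≡ suc (α + α + 3)
      double = solve-∀
      regroup : length A + length A ≡ suc (length A′ + length A′ + 3)
      regroup = trans (cong (λ A → length A + length A) A≡) (double (length A′))
    pick [] A≡ | no 2A≰B = contradiction (subst (λ A → length A + length A ≤ length B) (sym A≡) z≤n) 2A≰B
    -- With |A| = 1 and |B| < 2, the list `M` would have at most two vertices.
    pick (u ∷ []) A≡ | no 2A≰B = contradiction 3≤M (<⇒≱ (s≤s
      (≤-trans (≤-reflexive |M|) (+-mono-≤ |A|≤1 (≤-pred (≤-trans (≰⇒> 2A≰B) (+-mono-≤ |A|≤1 |A|≤1)))))))
      where
      |A|≤1 : length A ≤ 1
      |A|≤1 = ≤-reflexive (cong length A≡)

  -- Reductions: deleting two or three vertices and cloning as many.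

  -- `B⁺` is chosen before `T`, the factor by which the remaining graph may exceed its blowup. The
  -- gain is 16 = 2 · 2³: a factor 2 for each of at most three deleted vertices, and one to spare.
  record Reduction (L : List V) : Set₁ where
    field
      rest     : List V
      distinct : Unique rest
      shorter  : length rest < length L
      close    : length L ≤ 3 + length rest
      improve  : (B : Blowup (length rest)) → ∃ λ (B⁺ : Blowup (length L)) →
                   ∀ T → weight s rest ≤ T * value B → 16 * weight s L ≤ T * value B⁺

  lightPair⇒reduction : ∀ {L} → Unique L → 1303 ≤ length L → LightPair L → Reduction L
  lightPair⇒reduction {L} L-distinct big record { p = p ; q = q ; rest = rest ; perm = perm ; light = light } = record
    { rest = rest
    ; distinct = rest-distinct (Unique-resp-↭ perm L-distinct)
    ; shorter = subst (length rest <_) (sym size) (m≤n+m (1 + length rest) 1)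
    ; close = subst (_≤ 3 + length rest) (sym size) (n≤1+n _)
    ; improve = λ B → subst (λ k →
        ∃ λ (B⁺ : Blowup k) → ∀ T → weight s rest ≤ T * value B → 16 * weight s L ≤ T * value B⁺)
        (sym size) (improve B)
    }
    where
    size : length L ≡ 2 + length rest
    size = ↭-length perm
    rest-distinct : Unique (p ∷ q ∷ rest) → Unique rest
    rest-distinct (_ ∷ _ ∷ u) = u
    -- The bound 1303 leaves 1300 vertices even after the deletion of a triangle; here only two are
    -- deleted.
    1300≤rest : 1300 ≤ length rest
    1300≤rest = ≤-pred (≤-pred (≤-pred (≤-trans big (≤-trans (≤-reflexive size) (n≤1+n _)))))
    improve : (B : Blowup (length rest)) → ∃ λ (B⁺ : Blowup (2 + length rest)) →
      ∀ T → weight s rest ≤ T * value B → 16 * weight s L ≤ T * value B⁺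
    improve B =
      let B⁺ , grown = grow₂ {{>-nonZero (≤-trans (s≤s z≤n) 1300≤rest)}} B
      in B⁺ , λ T w≤ → subst (λ k → 16 * k ≤ T * value B⁺) (sym (trans (weight-↭ symmetric perm) (weight-∷∷ p q rest)))
        (absorb {a = 16} {C = 273375 ^ 3} {c = 256} {r = 96} {R = 100} {f = s p q * ∏ (codegree p q) rest}
          (length rest) light grown (ratio₂ 1300≤rest) T w≤)

  triangle⇒reduction : ∀ {L x y z rest} → Unique L → 1303 ≤ length L → L ↭ x ∷ y ∷ z ∷ rest →
    9 ≤ sum (edgeWeights s (x ∷ y ∷ z ∷ [])) → Reduction L
  triangle⇒reduction {L} {x} {y} {z} {rest} L-distinct big perm heavy = record
    { rest = rest
    ; distinct = rest-distinct xyz-distinct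
    ; shorter = subst (length rest <_) (sym size) (m≤n+m (1 + length rest) 2)
    ; close = ≤-reflexive size
    ; improve = λ B → subst (λ k →
        ∃ λ (B⁺ : Blowup k) → ∀ T → weight s rest ≤ T * value B → 16 * weight s L ≤ T * value B⁺)
        (sym size) (improve B)
    }
    where
    size : length L ≡ 3 + length rest
    size = ↭-length perm
    xyz-distinct : Unique (x ∷ y ∷ z ∷ rest)
    xyz-distinct = Unique-resp-↭ perm L-distinct
    rest-distinct : Unique (x ∷ y ∷ z ∷ rest) → Unique rest
    rest-distinct (_ ∷ _ ∷ _ ∷ u) = u
    1300≤rest : 1300 ≤ length rest
    1300≤rest = ≤-pred (≤-pred (≤-pred (≤-trans big (≤-reflexive size))))

    codegree₃ : V → ℕ
    codegree₃ u = s x u * (s y u * s z u)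

    sum≤6 : All (λ u → s x u + (s y u + s z u) ≤ 6) rest
    sum≤6 with (x≢y ∷ x≢z ∷ x≢) ∷ (y≢z ∷ y≢) ∷ z≢ ∷ _ ← xyz-distinct = All.tabulate λ {u} u∈ →
      +-cancelˡ-≤ 9 _ 6 (≤-trans (+-monoˡ-≤ _ heavy)
        (≤-trans (≤-reflexive (regroup (s x y) (s x z) (s y z) (s x u) (s y u) (s z u)))
          (quad≤15 ((x≢y ∷ x≢z ∷ All.lookup x≢ u∈ ∷ []) ∷ (y≢z ∷ All.lookup y≢ u∈ ∷ []) ∷ (All.lookup z≢ u∈ ∷ []) ∷ [] ∷ []))))
      where
      regroup : ∀ a b c d e f → a + (b + (c + 0)) + (d + (e + f)) ≡ a + (b + (d + (c + (e + (f + 0)))))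
      regroup = solve-∀

    -- 3375 = 15³ bounds the three edges of the triangle, and 512 = 8³ comes from the cube of the
    -- largest product of three numbers of sum at most 6.
    light : (s x y * s x z * s y z * ∏ codegree₃ rest) ^ 3 ≤ 512 ^ length rest * 3375 ^ 3
    light = begin
      (s x y * s x z * s y z * ∏ codegree₃ rest) ^ 3
        ≤⟨ ^-monoˡ-≤ 3 (*-mono-≤ (*-mono-≤ (*-mono-≤ (edge≤15 x y) (edge≤15 x z)) (edge≤15 y z))
             (∏≤^ (All.map (λ {u} → product₃≤ {s x u} {s y u} {s z u}) sum≤6))) ⟩
      (3375 * 8 ^ length rest) ^ 3
        ≡⟨ ^-distribʳ-* 3 3375 (8 ^ length rest) ⟩
      3375 ^ 3 * (8 ^ length rest) ^ 3
        ≡⟨ *-comm (3375 ^ 3) ((8 ^ length rest) ^ 3) ⟩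
      (8 ^ length rest) ^ 3 * 3375 ^ 3
        ≡⟨ cong (_* 3375 ^ 3) (^-comm 8 (length rest) 3) ⟩
      512 ^ length rest * 3375 ^ 3 ∎
      where open ≤-Reasoning

    improve : (B : Blowup (length rest)) → ∃ λ (B⁺ : Blowup (3 + length rest)) →
      ∀ T → weight s rest ≤ T * value B → 16 * weight s L ≤ T * value B⁺
    improve B =
      let B⁺ , grown = grow₃ {{>-nonZero (≤-trans (s≤s z≤n) 1300≤rest)}} B
      in B⁺ , λ T w≤ → subst (λ k → 16 * k ≤ T * value B⁺) (sym (trans (weight-↭ symmetric perm) (weight-∷∷∷ x y z rest)))
        (absorb {a = 16} {C = 3375 ^ 3} {c = 4096} {r = 512} {R = 1000}
          {f = s x y * s x z * s y z * ∏ codegree₃ rest} (length rest) light grown (ratio₃ 1300≤rest) T w≤)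

  -- Dense lists, on which the bounds of D(n) hold.

  -- The vertices may coincide, with diagonal value 1, as is required for clones.
  record Dense (L : List V) : Set where
    field
      edge≤3   : ∀ {x y} → x ∈ L → y ∈ L → s x y ≤ 3
      triple≤8 : ∀ {x y z} → x ∈ L → y ∈ L → z ∈ L → sum (edgeWeights s (x ∷ y ∷ z ∷ [])) ≤ 8

  heavyEdge⇒reduction : ∀ {L x y} → Unique L → 1303 ≤ length L → x ∈ L → y ∈ L → 4 ≤ s x y → Reduction L
  heavyEdge⇒reduction {L} {x} {y} L-distinct big x∈L y∈L 4≤sxy =
    lightPair⇒reduction L-distinct big record { LightPair pair ; perm = ↭-trans L↭ (LightPair.perm pair) }
    where
    y≢x : y ≢ x
    y≢x refl = from-no (4 ≤? 1) (subst (4 ≤_) (diagonal x) 4≤sxy)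
    M₁ = proj₁ (∈⇒↭∷ x∈L)
    L↭₁ = proj₂ (∈⇒↭∷ x∈L)
    y∈M₁ : y ∈ M₁
    y∈M₁ = ∈∷⇒∈ y≢x (∈-resp-↭ L↭₁ y∈L)
    M = proj₁ (∈⇒↭∷ y∈M₁)
    L↭ : L ↭ x ∷ y ∷ M
    L↭ = ↭-trans L↭₁ (prep x (proj₂ (∈⇒↭∷ y∈M₁)))
    pair : LightPair (x ∷ y ∷ M)
    pair = heavyEdge⇒lightPair x y M (Unique-resp-↭ L↭ L-distinct) 4≤sxy
      (≤-trans (≤ᵇ⇒≤ 3 1301 _) (≤-pred (≤-pred (≤-trans big (≤-reflexive (↭-length L↭))))))

  heavyTriangle⇒reduction : ∀ {L x y z} → Unique L → 1303 ≤ length L → (∀ {x y} → x ∈ L → y ∈ L → s x y ≤ 3) →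
    x ∈ L → y ∈ L → z ∈ L → 9 ≤ sum (edgeWeights s (x ∷ y ∷ z ∷ [])) → Reduction L
  heavyTriangle⇒reduction {L} {x} {y} {z} L-distinct big edge≤3 x∈L y∈L z∈L 9≤ =
    triangle⇒reduction L-distinct big
      (↭-trans L↭₁ (prep x (↭-trans M₁↭ (prep y (proj₂ (∈⇒↭∷ z∈M₂)))))) 9≤
    where
    -- A triple with a repeated vertex spans at most 1 + 3 + 3 = 7.
    y≢x : y ≢ x
    y≢x refl = from-no (9 ≤? 7) (≤-trans 9≤
      (+-mono-≤ (≤-reflexive (diagonal x)) (+-mono-≤ (edge≤3 x∈L z∈L) (+-monoˡ-≤ 0 (edge≤3 x∈L z∈L)))))
    z≢x : z ≢ x
    z≢x refl = from-no (9 ≤? 7) (≤-trans 9≤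
      (+-mono-≤ (edge≤3 x∈L y∈L) (+-mono-≤ (≤-reflexive (diagonal x)) (+-monoˡ-≤ 0 (edge≤3 y∈L x∈L)))))
    z≢y : z ≢ y
    z≢y refl = from-no (9 ≤? 7) (≤-trans 9≤
      (+-mono-≤ (edge≤3 x∈L y∈L) (+-mono-≤ (edge≤3 x∈L y∈L) (+-monoˡ-≤ 0 (≤-reflexive (diagonal y))))))
    L↭₁ = proj₂ (∈⇒↭∷ x∈L)
    y∈M₁ : y ∈ proj₁ (∈⇒↭∷ x∈L)
    y∈M₁ = ∈∷⇒∈ y≢x (∈-resp-↭ L↭₁ y∈L)
    M₁↭ = proj₂ (∈⇒↭∷ y∈M₁)
    z∈M₂ : z ∈ proj₁ (∈⇒↭∷ y∈M₁)
    z∈M₂ = ∈∷⇒∈ z≢y (∈-resp-↭ M₁↭ (∈∷⇒∈ z≢x (∈-resp-↭ L↭₁ z∈L)))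

  -- Heavy edges are excluded first: the bound 3 on edges is what shows that the vertices of a heavy
  -- triple are distinct.
  dense-or-reduction : ∀ L → Unique L → 1303 ≤ length L → Dense L ⊎ Reduction L
  dense-or-reduction L L-distinct big with any? (λ x → any? (λ y → 4 ≤? s x y) L) L
  ... | yes heavy =
    let x , x∈L , heavyˣ = find heavy
        y , y∈L , 4≤sxy = find heavyˣ
    in inj₂ (heavyEdge⇒reduction L-distinct big x∈L y∈L 4≤sxy)
  ... | no ¬heavy = split (any? (λ x → any? (λ y → any? (λ z → 9 ≤? sum (edgeWeights s (x ∷ y ∷ z ∷ []))) L) L) L)
    where
    edge≤3 : ∀ {x y} → x ∈ L → y ∈ L → s x y ≤ 3
    edge≤3 x∈ y∈ = ≤-pred (≰⇒> λ 4≤ → ¬heavy (lose x∈ (lose y∈ 4≤)))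
    split : Dec (Any (λ x → Any (λ y → Any (λ z → 9 ≤ sum (edgeWeights s (x ∷ y ∷ z ∷ []))) L) L) L) → Dense L ⊎ Reduction L
    split (no ¬triangle) = inj₁ record
      { edge≤3 = edge≤3
      ; triple≤8 = λ x∈ y∈ z∈ → ≤-pred (≰⇒> λ 9≤ → ¬triangle (lose x∈ (lose y∈ (lose z∈ 9≤))))
      }
    split (yes triangle) =
      let x , x∈L , triangleˣ = find triangle
          y , y∈L , triangleˣʸ = find triangleˣ
          z , z∈L , 9≤ = find triangleˣʸ
      in inj₂ (heavyTriangle⇒reduction L-distinct big edge≤3 x∈L y∈L z∈L 9≤)

module _ {V : Set} (G : MultiplicityFunction V) where
  open MultiplicityFunction G

  -- The clone sends 1 to its original and at most 3 + 3 to `z` and `u`, and the remaining triple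
  -- spans at most 8: in total 15.
  quad-repeated : ∀ {L x z u} → Dense G L → x ∈ L → z ∈ L → u ∈ L → sum (edgeWeights s (x ∷ x ∷ z ∷ u ∷ [])) ≤ 15
  quad-repeated {L} {x} {z} {u} dense x∈L z∈L u∈L = ≤-trans
    (≤-reflexive (regroup (s x x) (s x z) (s x u) (s z u)))
    (+-mono-≤ (≤-reflexive (diagonal x)) (+-mono-≤ (+-mono-≤ (edge≤3 x∈L z∈L) (edge≤3 x∈L u∈L)) (triple≤8 x∈L z∈L u∈L)))
    where
    open Dense dense
    regroup : ∀ d a b c → d + (a + (b + (a + (b + (c + 0))))) ≡ d + (a + b + (a + (b + (c + 0))))
    regroup = solve-∀

  dense-quad : ∀ {L} → Dense G L → ∀ {x y z u} → x ∈ L → y ∈ L → z ∈ L → u ∈ L →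
    sum (edgeWeights s (x ∷ y ∷ z ∷ u ∷ [])) ≤ 15
  dense-quad {L} dense {x} {y} {z} {u} x∈ y∈ z∈ u∈ = cases (x ≟ y) (x ≟ z) (x ≟ u) (y ≟ z) (y ≟ u) (z ≟ u)
    where
    permute : ∀ {ys} → x ∷ y ∷ z ∷ u ∷ [] ↭ ys → sum (edgeWeights s ys) ≤ 15 → sum (edgeWeights s (x ∷ y ∷ z ∷ u ∷ [])) ≤ 15
    permute p = subst (_≤ 15) (sym (sum-↭ (edgeWeights-↭ symmetric p)))

    cases : Dec (x ≡ y) → Dec (x ≡ z) → Dec (x ≡ u) → Dec (y ≡ z) → Dec (y ≡ u) → Dec (z ≡ u) →
      sum (edgeWeights s (x ∷ y ∷ z ∷ u ∷ [])) ≤ 15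
    cases (yes refl) _ _ _ _ _ = quad-repeated dense x∈ z∈ u∈
    cases _ (yes refl) _ _ _ _ = permute (prep x (swap y x ↭-refl)) (quad-repeated dense x∈ y∈ u∈)
    cases _ _ (yes refl) _ _ _ = permute (prep x (shift x (y ∷ z ∷ []) [])) (quad-repeated dense x∈ y∈ z∈)
    cases _ _ _ (yes refl) _ _ =
      permute (↭-trans (swap x y ↭-refl) (prep y (swap x y ↭-refl))) (quad-repeated dense y∈ x∈ u∈)
    cases _ _ _ _ (yes refl) _ =
      permute (↭-trans (swap x y ↭-refl) (prep y (shift y (x ∷ z ∷ []) []))) (quad-repeated dense y∈ x∈ z∈)
    cases _ _ _ _ _ (yes refl) =
      permute (↭-trans (shift z (x ∷ y ∷ []) (z ∷ [])) (prep z (shift z (x ∷ y ∷ []) []))) (quad-repeated dense z∈ x∈ y∈)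
    cases (no x≢y) (no x≢z) (no x≢u) (no y≢z) (no y≢u) (no z≢u) =
      quad≤15 ((x≢y ∷ x≢z ∷ x≢u ∷ []) ∷ (y≢z ∷ y≢u ∷ []) ∷ (z≢u ∷ []) ∷ [] ∷ [])

  -- `Admissible` quantifies over a whole type, `Dense` only over members of `L`; pulling back along
  -- `f` bridges the two.
  dense⇒admissible : ∀ {L} → Dense G L → {U : Set} (f : U → V) → (∀ i → f i ∈ L) → Admissible (λ i j → s (f i) (f j))
  dense⇒admissible dense f f∈L = record
    { symmetric = λ i j → symmetric (f i) (f j)
    ; positive  = λ i j → positive (f i) (f j)
    ; edge≤3    = λ i j → Dense.edge≤3 dense (f∈L i) (f∈L j)
    ; triple≤8  = λ i j k → Dense.triple≤8 dense (f∈L i) (f∈L j) (f∈L k)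
    ; quad≤15   = λ i j k l → dense-quad dense (f∈L i) (f∈L j) (f∈L k) (f∈L l)
    }

  denseBlowup : ∀ L → Dense G L → ∃ λ (B : Blowup (length L)) → weight s L ≡ value B
  denseBlowup L dense = record
    { admissible = dense⇒admissible dense (lookup L) ∈-lookup
    ; vertices   = allFin (length L)
    ; size       = length-tabulate id
    } , cong product (trans (cong (edgeWeights s) (sym (trans (map-tabulate id (lookup L)) (tabulate-lookup L))))
          (edgeWeights-map s (lookup L) (allFin (length L))))

  -- Induction on the number of vertices.

  -- Restoring up to three vertices lowers the exponent by at most 3, which uses 8 of the gain 16.
  -- The remaining 2 later gives strictness.
  gain : ∀ {K L} (r : Reduction G L) → let M = Reduction.rest r in
    (∃ λ (B : Blowup (length M)) → weight s M ≤ 2 ^ (K ∸ length M) * value B) →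
    ∃ λ (B⁺ : Blowup (length L)) → 2 * weight s L ≤ 2 ^ (K ∸ length L) * value B⁺
  gain {K} {L} r (B , le) = let B⁺ , improved = improve B in
    B⁺ , *-cancelˡ-≤ 8 (begin
      8 * (2 * weight s L)                          ≡⟨ *-assoc 8 2 (weight s L) ⟨
      16 * weight s L                               ≤⟨ improved (2 ^ (K ∸ length rest)) le ⟩
      2 ^ (K ∸ length rest) * value B⁺              ≤⟨ *-monoˡ-≤ (value B⁺) (^-monoʳ-≤ 2 exponents) ⟩
      2 ^ (3 + (K ∸ length L)) * value B⁺           ≡⟨ cong (_* value B⁺) (^-distribˡ-+-* 2 3 (K ∸ length L)) ⟩
      8 * 2 ^ (K ∸ length L) * value B⁺             ≡⟨ *-assoc 8 (2 ^ (K ∸ length L)) (value B⁺) ⟩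
      8 * (2 ^ (K ∸ length L) * value B⁺)           ∎)
    where
    open ≤-Reasoning
    open Reduction r
    exponents : K ∸ length rest ≤ 3 + (K ∸ length L)
    exponents = begin
      K ∸ length rest                ≤⟨ m≤n+m∸n (K ∸ length rest) 3 ⟩
      3 + (K ∸ length rest ∸ 3)      ≡⟨ cong (3 +_) (∸-+-assoc K (length rest) 3) ⟩
      3 + (K ∸ (length rest + 3))    ≡⟨ cong (λ k → 3 + (K ∸ k)) (+-comm (length rest) 3) ⟩
      3 + (K ∸ (3 + length rest))    ≤⟨ +-monoʳ-≤ 3 (∸-monoʳ-≤ K close) ⟩
      3 + (K ∸ length L)             ∎

  module _ {n₀ : ℕ} (1303≤n₀ : 1303 ≤ n₀) where

    -- A list shorter than `n₀` has weight at most 16 to the n₀², that is 2 to the 4n₀². An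
    -- allowance of this size, falling by one per vertex from `n₀` on, vanishes at `threshold`.
    threshold : ℕ
    threshold = n₀ + 4 * (n₀ * n₀)

    short : ∀ L → length L < n₀ → weight s L ≤ 2 ^ (threshold ∸ length L)
    short L L<n₀ = begin
      weight s L                        ≤⟨ weight≤^ (≤ᵇ⇒≤ 1 16 _) (λ x y → ≤-trans (edge≤15 x y) (n≤1+n 15)) L ⟩
      16 ^ (length L * length L)        ≡⟨ ^-*-assoc 2 4 (length L * length L) ⟩
      2 ^ (4 * (length L * length L))   ≤⟨ ^-monoʳ-≤ 2 exponents ⟩
      2 ^ (threshold ∸ length L)        ∎
      where
      open ≤-Reasoning
      L≤n₀ = <⇒≤ L<n₀
      exponents : 4 * (length L * length L) ≤ threshold ∸ length L
      exponents = begin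
        4 * (length L * length L)   ≤⟨ *-monoʳ-≤ 4 (*-mono-≤ L≤n₀ L≤n₀) ⟩
        4 * (n₀ * n₀)               ≡⟨ m+n∸m≡n n₀ (4 * (n₀ * n₀)) ⟨
        threshold ∸ n₀              ≤⟨ ∸-monoʳ-≤ threshold L≤n₀ ⟩
        threshold ∸ length L        ∎

    -- A reduction gains a factor 16 and removes at most 3 vertices, so the exponent can drop by one per vertex.
    bounded : ∀ k L → Unique L → length L ≤ k →
      ∃ λ (B : Blowup (length L)) → weight s L ≤ 2 ^ (threshold ∸ length L) * value B
    bounded k L L-distinct L≤k with length L <? n₀
    -- The power of 2 alone bounds the weight, so any blowup of value at least 1 will do.
    ... | yes L<n₀ = typesBlowup (length L) ,
      ≤-trans (short L L<n₀) (≤-trans (≤-reflexive (sym (*-identityʳ _)))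
        (*-monoʳ-≤ (2 ^ (threshold ∸ length L)) (value-positive (typesBlowup (length L)))))
    bounded zero L L-distinct L≤0 | no L≮n₀ = contradiction (≤-trans (s≤s L≤0) (≤-trans (s≤s z≤n) 1303≤n₀)) L≮n₀
    bounded (suc k) L L-distinct L≤k | no L≮n₀ with dense-or-reduction G L L-distinct (≤-trans 1303≤n₀ (≮⇒≥ L≮n₀))
    ... | inj₁ dense = let B , eq = denseBlowup L dense in B ,
      ≤-trans (≤-reflexive (trans eq (sym (*-identityˡ (value B)))))
        (*-monoˡ-≤ (value B) (m^n>0 2 (threshold ∸ length L)))
    ... | inj₂ r =
      let B , le = gain r (bounded k rest distinct (≤-pred (≤-trans shorter L≤k)))
      in B , ≤-trans (m≤m+n (weight s L) _) le
      where open Reduction r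

    -- The exponent has reached 0, so the spare factor 2 of `gain` makes a positive weight strictly
    -- smaller than the value of the blowup.
    beaten-or-dense : ∀ L → Unique L → threshold ≤ length L →
      Dense G L ⊎ ∃ λ (B : Blowup (length L)) → weight s L < value B
    beaten-or-dense L L-distinct big with dense-or-reduction G L L-distinct (≤-trans 1303≤n₀ (≤-trans (m≤m+n n₀ _) big))
    ... | inj₁ dense = inj₁ dense
    ... | inj₂ r =
      let B , le = gain r (bounded _ rest distinct ≤-refl)
      in inj₂ (B , <-≤-trans (m<m+n (weight s L) (≤-trans (weight-positive positive L) (≤-reflexive (sym (+-identityʳ _)))))
           (≤-trans le (≤-reflexive (trans (cong (λ k → 2 ^ k * value B) (m≤n⇒m∸n≡0 big)) (*-identityˡ (value B))))))
      where open Reduction r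

-- Translation between lists of vertices and multigraphs on `Fin n`.

All-edgeWeights : {A B : Set} {Q : B → Set} {s : A → A → B} → (∀ x y → Q (s x y)) → (xs : List A) → All Q (edgeWeights s xs)
All-edgeWeights q [] = []
All-edgeWeights q (x ∷ xs) = All.++⁺ (All.map⁺ (All.universal (q x) xs)) (All-edgeWeights q xs)

foldr-⊔≤ : ∀ {k ms} → All (_≤ k) ms → foldr _⊔_ 0 ms ≤ k
foldr-⊔≤ [] = z≤n
foldr-⊔≤ (m≤k ∷ ms≤k) = ⊔-lub m≤k (foldr-⊔≤ ms≤k)

admissible⇒D : ∀ {n} (w s : Multigraph n) → Admissible s → (∀ {x y} → x Fin.< y → w x y ≡ s x y) → D n w
admissible⇒D {n} w s adm w≡s =
  ( sum≤⇒F w s symmetric w≡s (λ { (x ∷ y ∷ z ∷ u ∷ []) _ refl → quad≤15 x y z u })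
  , foldr-⊔≤ (subst (All (_≤ 3)) (sym (weights-sym w s symmetric w≡s)) (All-edgeWeights edge≤3 (allFin n))))
  , sum≤⇒F w s symmetric w≡s (λ { (x ∷ y ∷ z ∷ []) _ refl → triple≤8 x y z })
  where open Admissible adm

-- The new vertices are the positions in the list, so clones become distinct vertices.
blowup⇒D : ∀ {n} (B : Blowup n) → ∃ λ (H : Multigraph n) → D n H × P H ≡ value B
blowup⇒D record { s = s ; admissible = adm ; vertices = xs ; size = refl } =
  H , admissible⇒D H H H-admissible (λ _ → refl) ,
  cong product (trans (weights-edges H) (trans (sym (edgeWeights-map s (lookup xs) (allFin (length xs))))
    (cong (edgeWeights s) (trans (map-tabulate id (lookup xs)) (tabulate-lookup xs)))))
  where
  open Admissible adm
  H : Multigraph (length xs)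
  H i j = s (lookup xs i) (lookup xs j)
  H-admissible : Admissible H
  H-admissible = record
    { symmetric = λ _ _ → symmetric _ _
    ; positive  = λ _ _ → positive _ _
    ; edge≤3    = λ _ _ → edge≤3 _ _
    ; triple≤8  = λ i j k → triple≤8 (lookup xs i) (lookup xs j) (lookup xs k)
    ; quad≤15   = λ i j k l → quad≤15 (lookup xs i) (lookup xs j) (lookup xs k) (lookup xs l)
    }

multiplicity : ∀ {n} → Multigraph n → Fin n → Fin n → ℕ
multiplicity w i j with Fin.<-cmp i j
... | tri< _ _ _ = w i j
... | tri≈ _ _ _ = 1
... | tri> _ _ _ = w j i

module _ {n : ℕ} (w : Multigraph n) where

  private
    s = multiplicity w

  multiplicity-< : ∀ {i j} → i Fin.< j → w i j ≡ s i j
  multiplicity-< {i} {j} i<j with Fin.<-cmp i j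
  ... | tri< _ _ _ = refl
  ... | tri≈ i≮j _ _ = contradiction i<j i≮j
  ... | tri> i≮j _ _ = contradiction i<j i≮j

  multiplicity-diagonal : ∀ i → s i i ≡ 1
  multiplicity-diagonal i with Fin.<-cmp i i
  ... | tri< _ i≢i _ = contradiction refl i≢i
  ... | tri≈ _ _ _ = refl
  ... | tri> _ i≢i _ = contradiction refl i≢i

  multiplicity-sym : ∀ i j → s i j ≡ s j i
  multiplicity-sym i j with Fin.<-cmp i j | Fin.<-cmp j i
  ... | tri< _ _ _   | tri> _ _ _   = refl
  ... | tri≈ _ _ _   | tri≈ _ _ _   = refl
  ... | tri> _ _ _   | tri< _ _ _   = refl
  ... | tri< _ _ j≮i | tri< j<i _ _ = contradiction j<i j≮i
  ... | tri< _ i≢j _ | tri≈ _ j≡i _ = contradiction (sym j≡i) i≢j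
  ... | tri≈ _ i≡j _ | tri< _ j≢i _ = contradiction (sym i≡j) j≢i
  ... | tri≈ _ i≡j _ | tri> _ j≢i _ = contradiction (sym i≡j) j≢i
  ... | tri> _ i≢j _ | tri≈ _ j≡i _ = contradiction (sym j≡i) i≢j
  ... | tri> i≮j _ _ | tri> _ _ i<j = contradiction i<j i≮j

  weights≡ : weights w ≡ edgeWeights s (allFin n)
  weights≡ = weights-sym w s multiplicity-sym multiplicity-<

  vertices↭ : ∀ {i j} → i ≢ j → ∃ λ M → allFin n ↭ i ∷ j ∷ M
  vertices↭ {i} {j} i≢j =
    let M₁ , p = ∈⇒↭∷ (∈-allFin i)
        M , q = ∈⇒↭∷ (∈∷⇒∈ (i≢j ∘ sym) (∈-resp-↭ p (∈-allFin j)))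
    in M , ↭-trans p (prep i q)

  multiplicityFunction : 4 ≤ n → F n 4 15 w → All (1 ≤_) (weights w) → MultiplicityFunction (Fin n)
  multiplicityFunction 4≤n Fw w-pos = record
    { _≟_ = Fin._≟_ ; s = s ; symmetric = multiplicity-sym ; diagonal = multiplicity-diagonal
    ; positive = positive ; edge≤15 = edge≤15 ; quad≤15 = quad≤15 }
    where
    quad≤15 : ∀ {x y z u} → Unique (x ∷ y ∷ z ∷ u ∷ []) → sum (edgeWeights s (x ∷ y ∷ z ∷ u ∷ [])) ≤ 15
    quad≤15 distinct = F⇒sum≤ w s multiplicity-sym multiplicity-< Fw _ distinct refl

    positive : ∀ i j → 1 ≤ s i j
    positive i j with i Fin.≟ j
    ... | yes refl = ≤-reflexive (sym (multiplicity-diagonal i))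
    -- With `i` and `j` moved to the front, their multiplicity is the first entry of the weight
    -- list.
    ... | no i≢j = All.head (All-resp-↭ (edgeWeights-↭ multiplicity-sym (proj₂ (vertices↭ i≢j))) (subst (All (1 ≤_)) weights≡ w-pos))

    edge≤15 : ∀ i j → s i j ≤ 15
    edge≤15 i j with i Fin.≟ j
    ... | yes refl = ≤-trans (≤-reflexive (multiplicity-diagonal i)) (≤ᵇ⇒≤ 1 15 _)
    ... | no i≢j = let M , p = vertices↭ i≢j in
      extend M (subst (4 ≤_) (trans (sym (length-tabulate id)) (↭-length p)) 4≤n) (Unique-resp-↭ p (Unique.allFin⁺ n))
      where
      extend : ∀ M → 4 ≤ length (i ∷ j ∷ M) → Unique (i ∷ j ∷ M) → s i j ≤ 15
      -- Two further vertices complete the pair to a quadruple, whose total bounds the single edge.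
      extend (z ∷ u ∷ _) _ distinct = m+n≤o⇒m≤o (s i j) (quad≤15 (Unique.take⁺ 4 distinct))
      extend [] (s≤s (s≤s ()))
      extend (_ ∷ []) (s≤s (s≤s (s≤s ())))

  -- Comparison of F(n,4,15) with D(n).

  D-or-beaten : ∀ {n₀} → 1303 ≤ n₀ → n₀ + 4 * (n₀ * n₀) ≤ n → F n 4 15 w →
    D n w ⊎ ∃ λ (H : Multigraph n) → D n H × P w < P H
  D-or-beaten {n₀} 1303≤n₀ big Fw with All.all? (1 ≤?_) (weights w)
  -- A multiplicity 0 makes `P` vanish, and the explicit construction has positive value.
  ... | no ¬pos =
    let H , H∈D , PH≡ = blowup⇒D (typesBlowup n)
    in inj₂ (H , H∈D , subst₂ _<_ (sym (zero-product (All.¬All⇒Any¬ (1 ≤?_) _ ¬pos))) (sym PH≡) (value-positive (typesBlowup n)))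
    where
    zero-product : ∀ {ms} → Any (λ m → ¬ 1 ≤ m) ms → product ms ≡ 0
    zero-product (here {m} {ms} m<1) = cong (_* product ms) (n<1⇒n≡0 (≰⇒> m<1))
    zero-product (there {m} any) = trans (cong (m *_) (zero-product any)) (*-zeroʳ m)
  ... | yes pos = convert (beaten-or-dense G 1303≤n₀ (allFin n) (Unique.allFin⁺ n) (subst (n₀ + 4 * (n₀ * n₀) ≤_) (sym size) big))
    where
    size : length (allFin n) ≡ n
    size = length-tabulate id
    G : MultiplicityFunction (Fin n)
    G = multiplicityFunction (≤-trans (≤ᵇ⇒≤ 4 1303 _) (≤-trans 1303≤n₀ (≤-trans (m≤m+n n₀ _) big))) Fw pos
    convert : Dense G (allFin n) ⊎ (∃ λ (B : Blowup (length (allFin n))) → weight s (allFin n) < value B) →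
      D n w ⊎ ∃ λ (H : Multigraph n) → D n H × P w < P H
    convert (inj₁ dense) = inj₁ (admissible⇒D w s (dense⇒admissible G dense id ∈-allFin) multiplicity-<)
    convert (inj₂ beaten) =
      let B , w<B = subst (λ k → ∃ λ (B : Blowup k) → weight s (allFin n) < value B) size beaten
          H , H∈D , PH≡ = blowup⇒D B
      in inj₂ (H , H∈D , subst₂ _<_ (cong product (sym weights≡)) (sym PH≡) w<B)

theorem4p2 : ∃ λ N → (n : ℕ) → N ≤ n → (G : Multigraph n) →
    IsPMax (F n 4 15) G ⇔ IsPMax (D n) G
theorem4p2 = 1303 + 4 * (1303 * 1303) , λ n N≤n G → mk⇔ (to N≤n) (from N≤n)
  where
  D⇒F : ∀ {n} {G : Multigraph n} → D n G → F n 4 15 G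
  D⇒F ((G∈F , _) , _) = G∈F

  to : ∀ {n G} → 1303 + 4 * (1303 * 1303) ≤ n → IsPMax (F n 4 15) G → IsPMax (D n) G
  to {G = G} N≤n (G∈F , G-max) with D-or-beaten G ≤-refl N≤n G∈F
  ... | inj₁ G∈D = G∈D , λ H H∈D → G-max H (D⇒F {G = H} H∈D)
  ... | inj₂ (H , H∈D , PG<PH) = contradiction (G-max H (D⇒F {G = H} H∈D)) (<⇒≱ PG<PH)

  from : ∀ {n G} → 1303 + 4 * (1303 * 1303) ≤ n → IsPMax (D n) G → IsPMax (F n 4 15) G
  from {G = G} N≤n (G∈D , G-max) = D⇒F {G = G} G∈D , λ H H∈F → bound H (D-or-beaten H ≤-refl N≤n H∈F)
    where
    bound : ∀ H → _ → P H ≤ P G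
    bound H (inj₁ H∈D) = G-max H H∈D
    bound H (inj₂ (H′ , H′∈D , PH<PH′)) = ≤-trans (<⇒≤ PH<PH′) (G-max H′ H′∈D)
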